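{- There exist rational functions $\tilde A_h(q)$ and $\tilde B_h(q)$ in $q$ (for integers $h\ge1$) such that $$\tilde a_h(q)=(-q;q)_\infty\,\tilde A_h(q)\quad(h\ge1),$$ $$\tilde b_{2h}(q)=(-q;q)_\infty\,\tilde B_{2h}(q)\quad(h\ge1),$$ $$\tilde b_{2h+1}(q)=(-q;q)_\infty\Bigl(\tilde B_{2h+1}(q)+\sum_{k=1}^\infty\frac{q^k}{1+q^k}\Bigr)\quad(h\ge0).$$
   Context: A partition $\lambda=(\lambda_1\ge\lambda_2\ge\dots\ge\lambda_\ell>0)$ of $n$ is drawn as its Ferrers diagram: left-adjusted rows of boxes, with $\lambda_i$ boxes in row $i$. The hook number of the box in row $i$ and column $j$ is the number of boxes in the L-shape consisting of that box, all boxes to its right in the same row, and all boxes below it in the same column. $\mathcal H(\lambda)$ denotes the multiset of all hook numbers of $\lambda$. Let $\mathcal O(n)$ be the set of partitions of $n$ all of whose parts are odd and $\mathcal D(n)$ the set of partitions of $n$ whose parts are pairwise distinct. For integers $h\ge1$ and $n\ge0$, define $$a_h(n)=\sum_{\lambda\in\mathcal O(n)}\#\{x\in\mathcal H(\lambda):x=h\},\qquad b_h(n)=\sum_{\lambda\in\mathcal D(n)}\#\{x\in\mathcal H(\lambda):x=h\},$$ counted with multiplicity, and set $\tilde a_h(q)=\sum_{n\ge0}a_h(n)q^n$, $\tilde b_h(q)=\sum_{n\ge0}b_h(n)q^n$. Also $(-q;q)_\infty=\prod_{j\ge1}(1+q^j)$. -}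

module Defs where

open import Data.Bool.Base using (if_then_else_)
open import Data.Fin.Base using (toℕ)
open import Data.Integer.Base using (+_)
open import Data.List.Base
  using (List; []; _∷_; [_]; _++_; map; concatMap; filter; length; replicate; upTo)
open import Data.List.Relation.Unary.All using (all?)
open import Data.List.Relation.Unary.Unique.DecPropositional using (unique?)
open import Data.Nat.Base as ℕ using (ℕ; zero; suc; _∸_; _≤_)
open import Data.Nat.Divisibility using (_∣?_)
open import Data.Nat.ListAction using (sum)
import Data.Nat.Properties as ℕ
open import Data.Product.Base using (_×_; ∃-syntax)
open import Data.Rational.Base as ℚ using (ℚ; 0ℚ; 1ℚ)
import Data.Rational.Properties as ℚ
open import Algebra.Bundles using (CommutativeRing)
open import Algebra.Properties.Semiring.Sum
  (CommutativeRing.semiring ℚ.+-*-commutativeRing) using (sum⁺-syntax; sum-syntax)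
open import Relation.Binary.PropositionalEquality.Core using (_≡_)
open import Relation.Nullary.Decidable.Core using (does; ¬?)
open import Relation.Nullary.Negation.Core using (¬_)

-- The partitions of n into parts of size at most m, as weakly decreasing lists,
-- each listed once: c is the multiplicity of the largest admissible part.
partitions≤ : (m n : ℕ) → List (List ℕ)
partitions≤ zero    zero    = [ [] ]
partitions≤ zero    (suc _) = []
partitions≤ (suc m) n =
  concatMap (λ c → map (replicate c (suc m) ++_) (partitions≤ m (n ∸ c ℕ.* suc m)))
            (upTo (suc (n ℕ./ suc m)))

partitions : ℕ → List (List ℕ)
partitions n = partitions≤ n n

𝒪 : ℕ → List (List ℕ)
𝒪 n = filter (all? (λ x → ¬? (2 ∣? x))) (partitions n)

𝒟 : ℕ → List (List ℕ)
𝒟 n = filter (unique? ℕ._≟_) (partitions n)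

-- The hook numbers of the first row, followed by those of the remaining rows.
-- The box in column j (counted from 0) of a first row of length x contributes
-- itself, the boxes to its right, and one box below it for every later row of
-- length greater than j.
hookNumbers : List ℕ → List ℕ
hookNumbers []       = []
hookNumbers (x ∷ xs) =
  map (λ j → 1 ℕ.+ (x ∸ suc j) ℕ.+ length (filter (j ℕ.<?_) xs)) (upTo x)
  ++ hookNumbers xs

hookCount : ℕ → List ℕ → ℕ
hookCount h λ′ = length (filter (ℕ._≟ h) (hookNumbers λ′))

a b : (h n : ℕ) → ℕ
a h n = sum (map (hookCount h) (𝒪 n))
b h n = sum (map (hookCount h) (𝒟 n))

PowerSeries : Set
PowerSeries = ℕ → ℚ

infix  4 _≈_
infixl 6 _+_ _-_
infixl 7 _*_
infixr 8 _^_

_≈_ : PowerSeries → PowerSeries → Set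
f ≈ g = ∀ n → f n ≡ g n

q^ : ℕ → PowerSeries
q^ k n = if does (n ℕ.≟ k) then 1ℚ else 0ℚ

0# 1# : PowerSeries
0# _ = 0ℚ
1#   = q^ 0

_+_ _-_ _*_ : PowerSeries → PowerSeries → PowerSeries
(f + g) n = f n ℚ.+ g n
(f - g) n = f n ℚ.- g n
(f * g) n = ∑[ i ≤ n ] (f (toℕ i) ℚ.* g (n ∸ toℕ i))

_^_ : PowerSeries → ℕ → PowerSeries
f ^ zero  = 1#
f ^ suc k = f * f ^ k

-- The inverse of a series with constant term 1, as the geometric series
-- Σ_{j≥0} (1 - f)^j; the terms with j > n do not affect the coefficient of q^n.
-- (Not meaningful for other constant terms.)
inverse₁ : PowerSeries → PowerSeries
inverse₁ f n = ∑[ j ≤ n ] ((1# - f) ^ toℕ j) n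

-- Σ_{k≥1} F k, for a family in which F k is divisible by q^k, so that only
-- F 1, …, F n contribute to the coefficient of q^n.
∑∞ : (ℕ → PowerSeries) → PowerSeries
∑∞ F n = ∑[ i < n ] F (suc (toℕ i)) n

∏ : ℕ → (ℕ → PowerSeries) → PowerSeries
∏ zero    F = 1#
∏ (suc N) F = ∏ N F * F (suc N)

-- Π_{j≥1} F j, for a family in which F j - 1 is divisible by q^j, so that only
-- F 1, …, F n affect the coefficient of q^n.
∏∞ : (ℕ → PowerSeries) → PowerSeries
∏∞ F n = ∏ n F n

⟨-q,q⟩∞ : PowerSeries
⟨-q,q⟩∞ = ∏∞ (λ j → 1# + q^ j)

∑q^k/⟨1+q^k⟩ : PowerSeries
∑q^k/⟨1+q^k⟩ = ∑∞ (λ k → q^ k * inverse₁ (1# + q^ k))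

ã b̃ : ℕ → PowerSeries
ã h n = + a h n ℚ./ 1
b̃ h n = + b h n ℚ./ 1

IsPolynomial : PowerSeries → Set
IsPolynomial f = ∃[ N ] (∀ n → N ≤ n → f n ≡ 0ℚ)

-- R is the expansion at q = 0 of a rational function P/Q ∈ ℚ(q). As ℚ[[q]] is an
-- integral domain, Q * R ≈ P with Q ≠ 0 determines R.
IsRational : PowerSeries → Set
IsRational R = ∃[ P ] ∃[ Q ]
  (IsPolynomial P × IsPolynomial Q × ¬ (Q ≈ 0#) × Q * R ≈ P)

{-# OPTIONS --safe #-}

-- Divide the generating function of the boxes of arm length a and leg length l by
-- (-q;q)_∞. For distinct parts, a box in column j of a row of length j+a leaves
-- x^{l+1} / ((1+x)(1+xq)⋯(1+xq^a)) at x = q^j, times a polynomial in q. Its sum over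
-- j ≥ 1 telescopes to a rational function by induction on l when l < a, and there are
-- no such boxes when l > a; for l = a it is Σ q^j/(1+q^j) up to a rational function,
-- and a = l occurs for hook length 2a+1 only. For odd parts (where 1/((1-q)(1-q^3)⋯) = (-q;q)_∞ by
-- Euler), a row of length p leaves a polynomial in q^p without constant term, whose
-- sum over odd p is a combination of geometric series.

module Submission where

open import Algebra.Bundles using (CommutativeRing)
import Algebra.Construct.Pointwise as Pointwise
import Algebra.Properties.Semiring.Sum as SemiringSum
import Algebra.Solver.Ring as RingSolver
open import Algebra.Solver.Ring.AlmostCommutativeRing
  using (fromCommutativeRing; _-Raw-AlmostCommutative⟶_)
open import Data.Bool.Base using (if_then_else_; true; false)
open import Data.Fin.Base as Fin using (Fin; toℕ)
open import Data.Fin.Properties using (toℕ≤pred[n]; toℕ-inject₁; toℕ-fromℕ)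
open import Data.Integer.Base as ℤ using (+_)
import Data.Integer.Properties as ℤ
open import Data.List.Base
  using (List; []; _∷_; [_]; _++_; map; concatMap; filter; length; replicate; upTo; applyUpTo)
import Data.List.Properties as List
open import Data.List.Relation.Unary.All as All using (All; []; _∷_; all?)
import Data.List.Relation.Unary.All.Properties as All
open import Data.List.Relation.Unary.AllPairs using (_∷_)
open import Data.Maybe.Base using (just; nothing)
open import Data.Nat.Base as ℕ using (ℕ; zero; suc; _≤_; _<_; z≤n; s≤s; _∸_)
open import Data.Nat.DivMod using (m<n⇒m/n≡0; m/n≡1+[m∸n]/n)
open import Data.Nat.Divisibility
  using (_∣?_; ∣m∣n⇒∣m+n; ∣m+n∣m⇒∣n; ∣-refl; _∣0; ∣1⇒≡1) renaming (_∣_ to _∣ℕ_)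
open import Data.Nat.ListAction using (sum)
import Data.Nat.Properties as ℕ
open import Data.List.Relation.Unary.Unique.DecPropositional ℕ._≟_ using (unique?)
open import Data.Product.Base using (_×_; _,_; proj₁; proj₂; ∃-syntax; Σ-syntax)
open import Data.Rational.Base as ℚ using (ℚ; 0ℚ; 1ℚ)
import Data.Rational.Properties as ℚ
open import Data.Rational.Solver using (module +-*-Solver)
import Data.Rational.Unnormalised.Base as ℚᵘ
import Data.Rational.Unnormalised.Properties as ℚᵘ
open import Function.Base using (_∘_)
open import Function.Bundles using (mk⇔)
open import Level using (Level; 0ℓ)
open import Relation.Binary.Definitions using (WeaklyDecidable; tri<; tri≈; tri>)
open import Relation.Binary.PropositionalEquality
  using (_≡_; _≢_; refl; sym; trans; cong; cong₂; subst; module ≡-Reasoning)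
import Relation.Binary.Reasoning.Setoid as SetoidReasoning
open import Relation.Nullary.Decidable using (Dec; yes; no; does; ¬?; dec-true; dec-false; does-⇔)
open import Relation.Nullary.Negation using (¬_; contradiction)
open import Relation.Unary using (Decidable)
open import Defs

-- All counting is done with parts at most m, where adjoining one more part size gives exact
-- identities between finite sums and products; limits are taken afterwards. For distinct parts the
-- polynomial is q^a e_l(1, q, ..., q^(a-1)): the rows below the box that reach column j have
-- distinct lengths among j, ..., j+a-1, and any l of these may be chosen. Hence l > a is
-- impossible. The telescoping relation for the sum T(l,a) carries the coefficient q^l - q^a. It
-- vanishes exactly for l = a, and this is where the exceptional series comes from. On the diagonal
-- another relation takes over, q^(a+1) T(a+1,a+1) = T(a,a) - T(a,a+1), which descends to T(0,0),
-- the exceptional series itself. The prefactor q^a e_a(1, ..., q^(a-1)) absorbs the powers of q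
-- arising in the descent, so the series appears with coefficient 1 for every a. For odd parts,
-- sizes repeat and e_l becomes a complete homogeneous polynomial in the odd powers among q^(p-a),
-- ..., q^p. The parity conditions on these exponents are the only obstacle to summing over p, and
-- they are carried along as periodic factors.

module ∑ = SemiringSum (CommutativeRing.semiring ℚ.+-*-commutativeRing)

-- (f * g) (suc n) reduces to f 0 * g (suc n) + (tail f * g) n, the recursion behind the inductions on coefficients.
tail : PowerSeries → PowerSeries
tail f = f ∘ suc

-- Ring axioms for the Cauchy product

*-cong-≤ : ∀ {f f′ g g′} n → (∀ i → i ≤ n → f i ≡ f′ i) → (∀ i → i ≤ n → g i ≡ g′ i) →
           (f * g) n ≡ (f′ * g′) n
*-cong-≤ {f} {f′} {g} {g′} n f≡ g≡ = ∑.sum-cong-≗ {suc n} λ i →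
  cong₂ ℚ._*_ (f≡ (toℕ i) (toℕ≤pred[n] i)) (g≡ (n ∸ toℕ i) (ℕ.m∸n≤m n (toℕ i)))

*-cong : ∀ {f f′ g g′} → f ≈ f′ → g ≈ g′ → f * g ≈ f′ * g′
*-cong {f} {f′} {g} {g′} f≈ g≈ n = *-cong-≤ {f} {f′} {g} {g′} n (λ i _ → f≈ i) (λ i _ → g≈ i)

*-distribʳ : ∀ h f g → (f + g) * h ≈ f * h + g * h
*-distribʳ h f g zero =
  +-*-Solver.solve 3 (λ f g h → (f :+ g) :* h :+ con 0ℚ := f :* h :+ con 0ℚ :+ (g :* h :+ con 0ℚ)) refl (f 0) (g 0) (h 0)
  where open +-*-Solver
*-distribʳ h f g (suc n) = trans (cong ((f 0 ℚ.+ g 0) ℚ.* h (suc n) ℚ.+_) (*-distribʳ h (tail f) (tail g) n))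
  (+-*-Solver.solve 5 (λ f g h x y → (f :+ g) :* h :+ (x :+ y) := f :* h :+ x :+ (g :* h :+ y)) refl
    (f 0) (g 0) (h (suc n)) _ _)
  where open +-*-Solver

*-zeroˡ : ∀ f → 0# * f ≈ 0#
*-zeroˡ f zero    = trans (ℚ.+-identityʳ _) (ℚ.*-zeroˡ (f 0))
*-zeroˡ f (suc n) = cong₂ ℚ._+_ (ℚ.*-zeroˡ (f (suc n))) (*-zeroˡ f n)

*-identityˡ : ∀ f → 1# * f ≈ f
*-identityˡ f zero    = trans (ℚ.+-identityʳ _) (ℚ.*-identityˡ (f 0))
*-identityˡ f (suc n) = trans (cong₂ ℚ._+_ (ℚ.*-identityˡ (f (suc n))) (*-zeroˡ f n)) (ℚ.+-identityʳ _)

-- The tail of a product, `tail (f * g)`, unfolds to `scale (f 0) (tail g) + tail f * g`;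
-- associativity meets products in this form.
scale : ℚ → PowerSeries → PowerSeries
scale c f n = c ℚ.* f n

scale-* : ∀ c f g → scale c f * g ≈ scale c (f * g)
scale-* c f g zero =
  +-*-Solver.solve 3 (λ c f g → (c :* f) :* g :+ con 0ℚ := c :* (f :* g :+ con 0ℚ)) refl c (f 0) (g 0)
  where open +-*-Solver
scale-* c f g (suc n) = trans (cong ((c ℚ.* f 0) ℚ.* g (suc n) ℚ.+_) (scale-* c (tail f) g n))
  (+-*-Solver.solve 4 (λ c f g x → (c :* f) :* g :+ c :* x := c :* (f :* g :+ x)) refl c (f 0) (g (suc n)) _)
  where open +-*-Solver

*-assoc : ∀ f g h → (f * g) * h ≈ f * (g * h)
*-assoc f g h zero =
  +-*-Solver.solve 3 (λ f g h → (f :* g :+ con 0ℚ) :* h :+ con 0ℚ := f :* (g :* h :+ con 0ℚ) :+ con 0ℚ) refl (f 0) (g 0) (h 0)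
  where open +-*-Solver
*-assoc f g h (suc n) = begin
  (f 0 ℚ.* g 0 ℚ.+ 0ℚ) ℚ.* h (suc n) ℚ.+ ((scale (f 0) (tail g) + tail f * g) * h) n
    ≡⟨ cong ((f 0 ℚ.* g 0 ℚ.+ 0ℚ) ℚ.* h (suc n) ℚ.+_) (*-distribʳ h (scale (f 0) (tail g)) (tail f * g) n) ⟩
  (f 0 ℚ.* g 0 ℚ.+ 0ℚ) ℚ.* h (suc n) ℚ.+ ((scale (f 0) (tail g) * h) n ℚ.+ ((tail f * g) * h) n)
    ≡⟨ cong ((f 0 ℚ.* g 0 ℚ.+ 0ℚ) ℚ.* h (suc n) ℚ.+_) (cong₂ ℚ._+_ (scale-* (f 0) (tail g) h n) (*-assoc (tail f) g h n)) ⟩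
  (f 0 ℚ.* g 0 ℚ.+ 0ℚ) ℚ.* h (suc n) ℚ.+ (f 0 ℚ.* (tail g * h) n ℚ.+ (tail f * (g * h)) n)
    ≡⟨ +-*-Solver.solve 5 (λ f g h x y → (f :* g :+ con 0ℚ) :* h :+ (f :* x :+ y) := f :* (g :* h :+ x) :+ y)
         refl (f 0) (g 0) (h (suc n)) _ _ ⟩
  f 0 ℚ.* (g 0 ℚ.* h (suc n) ℚ.+ (tail g * h) n) ℚ.+ (tail f * (g * h)) n ∎
  where
  open ≡-Reasoning
  open +-*-Solver

-- The product unfolds along its left factor only. Unfolding both sides, with commutations at
-- smaller degrees in between, leaves the common remainder `tail f * tail g` two degrees down, hence
-- the separate case of degree 1.
*-comm : ∀ f g → f * g ≈ g * f
*-comm f g zero          = cong (ℚ._+ 0ℚ) (ℚ.*-comm (f 0) (g 0))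
*-comm f g (suc zero)    =
  +-*-Solver.solve 4 (λ f f′ g g′ → f :* g′ :+ (f′ :* g :+ con 0ℚ) := g :* f′ :+ (g′ :* f :+ con 0ℚ)) refl (f 0) (f 1) (g 0) (g 1)
  where open +-*-Solver
*-comm f g (suc (suc n)) = begin
  f 0 ℚ.* g (suc (suc n)) ℚ.+ (tail f * g) (suc n)
    ≡⟨ cong (f 0 ℚ.* g (suc (suc n)) ℚ.+_) (*-comm (tail f) g (suc n)) ⟩
  f 0 ℚ.* g (suc (suc n)) ℚ.+ (g 0 ℚ.* f (suc (suc n)) ℚ.+ (tail g * tail f) n)
    ≡⟨ cong (λ x → f 0 ℚ.* g (suc (suc n)) ℚ.+ (g 0 ℚ.* f (suc (suc n)) ℚ.+ x)) (*-comm (tail g) (tail f) n) ⟩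
  f 0 ℚ.* g (suc (suc n)) ℚ.+ (g 0 ℚ.* f (suc (suc n)) ℚ.+ (tail f * tail g) n)
    ≡⟨ +-*-Solver.solve 3 (λ x y z → x :+ (y :+ z) := y :+ (x :+ z)) refl (f 0 ℚ.* g (suc (suc n))) (g 0 ℚ.* f (suc (suc n))) _ ⟩
  g 0 ℚ.* f (suc (suc n)) ℚ.+ (f 0 ℚ.* g (suc (suc n)) ℚ.+ (tail f * tail g) n)
    ≡⟨ cong (g 0 ℚ.* f (suc (suc n)) ℚ.+_) (*-comm f (tail g) (suc n)) ⟩
  g 0 ℚ.* f (suc (suc n)) ℚ.+ (tail g * f) (suc n) ∎
  where
  open ≡-Reasoning
  open +-*-Solver

*-distribˡ : ∀ h f g → h * (f + g) ≈ h * f + h * g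
*-distribˡ h f g n = trans (*-comm h (f + g) n)
  (trans (*-distribʳ h f g n) (cong₂ ℚ._+_ (*-comm f h n) (*-comm g h n)))

powerSeriesRing : CommutativeRing 0ℓ 0ℓ
powerSeriesRing = record
  { Carrier = PowerSeries
  ; _≈_     = _≈_
  ; _+_     = _+_
  ; _*_     = _*_
  ; -_      = λ f n → ℚ.- f n
  ; 0#      = 0#
  ; 1#      = 1#
  ; isCommutativeRing = record
    { isRing = record
      { +-isAbelianGroup = Pointwise.isAbelianGroup ℕ ℚ.+-0-isAbelianGroup
      ; *-cong           = *-cong
      ; *-assoc          = *-assoc
      ; *-identity       = *-identityˡ , λ f n → trans (*-comm f 1# n) (*-identityˡ f n)
      ; distrib          = *-distribˡ , *-distribʳ
      }
    ; *-comm = *-comm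
    }
  }

-- Rational constants as coefficients for the ring solver

constant : ℚ → PowerSeries
constant c n = if does (n ℕ.≟ 0) then c else 0ℚ

constant-* : ∀ c d → constant (c ℚ.* d) ≈ constant c * constant d
constant-* c d zero    = sym (ℚ.+-identityʳ _)
constant-* c d (suc n) = sym (cong₂ ℚ._+_ (ℚ.*-zeroʳ c) (*-zeroˡ (constant d) n))

-- Under this embedding `constant 1ℚ` unfolds to `1#`, so solved equations apply as they are,
-- whereas `constant 0ℚ` agrees with `0#` only after a case split on the degree.
constant-hom : CommutativeRing.rawRing ℚ.+-*-commutativeRing
               -Raw-AlmostCommutative⟶ fromCommutativeRing powerSeriesRing
constant-hom = record
  { ⟦_⟧    = constant
  ; +-homo = λ { c d zero → refl ; c d (suc n) → refl }
  ; *-homo = constant-*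
  ; -‿homo = λ { c zero → refl ; c (suc n) → refl }
  ; 0-homo = λ { zero → refl ; (suc n) → refl }
  ; 1-homo = λ { zero → refl ; (suc n) → refl }
  }

constant-≟ : WeaklyDecidable (λ c d → constant c ≈ constant d)
constant-≟ c d with c ℚ.≟ d
... | yes refl = just λ _ → refl
... | no  _    = nothing

module PS where
  open CommutativeRing powerSeriesRing public
    using (setoid; +-assoc; +-identityˡ; *-identityʳ; zeroʳ)
    renaming (refl to ≈-refl)

module Solver = RingSolver (CommutativeRing.rawRing ℚ.+-*-commutativeRing)
  (fromCommutativeRing powerSeriesRing) constant-hom constant-≟

module ≈-Reasoning = SetoidReasoning PS.setoid

*-congˡ : ∀ f {g g′} → g ≈ g′ → f * g ≈ f * g′
*-congˡ f {g} {g′} g≈ = *-cong {f} {f} {g} {g′} (λ _ → refl) g≈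

*-congʳ : ∀ g {f f′} → f ≈ f′ → f * g ≈ f′ * g
*-congʳ g {f} {f′} f≈ = *-cong {f} {f′} {g} {g} f≈ (λ _ → refl)

+-congˡ : ∀ f {g g′} → g ≈ g′ → f + g ≈ f + g′
+-congˡ f g≈ n = cong (f n ℚ.+_) (g≈ n)

+-congʳ : ∀ g {f f′} → f ≈ f′ → f + g ≈ f′ + g
+-congʳ g f≈ n = cong (ℚ._+ g n) (f≈ n)

+-cong : ∀ {f f′ g g′} → f ≈ f′ → g ≈ g′ → f + g ≈ f′ + g′
+-cong f≈ g≈ n = cong₂ ℚ._+_ (f≈ n) (g≈ n)

minus-cong : ∀ {f f′ g g′} → f ≈ f′ → g ≈ g′ → f - g ≈ f′ - g′
minus-cong f≈ g≈ n = cong₂ ℚ._-_ (f≈ n) (g≈ n)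

minus-congˡ : ∀ f {g g′} → g ≈ g′ → f - g ≈ f - g′
minus-congˡ f g≈ n = cong (λ x → f n ℚ.- x) (g≈ n)

≈-sym : ∀ {f g} → f ≈ g → g ≈ f
≈-sym p n = sym (p n)

≈-trans : ∀ {f g h} → f ≈ g → g ≈ h → f ≈ h
≈-trans p r n = trans (p n) (r n)

-- Agreement up to a degree and divisibility by powers of q

infix 4 _≈[_]_

_≈[_]_ : PowerSeries → ℕ → PowerSeries → Set
f ≈[ n ] g = ∀ i → i ≤ n → f i ≡ g i

*-cong-≈[] : ∀ {f f′ g g′ n} → f ≈[ n ] f′ → g ≈[ n ] g′ → f * g ≈[ n ] f′ * g′
*-cong-≈[] {f} {f′} {g} {g′} f≈ g≈ i i≤n = *-cong-≤ {f} {f′} {g} {g′} i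
  (λ j j≤i → f≈ j (ℕ.≤-trans j≤i i≤n)) (λ j j≤i → g≈ j (ℕ.≤-trans j≤i i≤n))

q^_∣_ : ℕ → PowerSeries → Set
q^ k ∣ f = ∀ i → i < k → f i ≡ 0ℚ

q^*-shift : ∀ k f n → (q^ k * f) (k ℕ.+ n) ≡ f n
q^*-shift zero    f n = *-identityˡ f n
q^*-shift (suc k) f n = trans
  (cong₂ ℚ._+_ (ℚ.*-zeroˡ (f (suc (k ℕ.+ n)))) (q^*-shift k f n)) (ℚ.+-identityˡ (f n))

q^∣q^* : ∀ k f → q^ k ∣ (q^ k * f)
q^∣q^* (suc k) f zero    _         = trans (ℚ.+-identityʳ _) (ℚ.*-zeroˡ (f 0))
q^∣q^* (suc k) f (suc i) (s≤s i<k) = trans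
  (cong₂ ℚ._+_ (ℚ.*-zeroˡ (f (suc i))) (q^∣q^* k f i i<k)) (ℚ.+-identityˡ 0ℚ)

q^-≢ : ∀ {k i} → i ≢ k → q^ k i ≡ 0ℚ
q^-≢ {k} {i} i≢k = cong (λ b → if b then 1ℚ else 0ℚ) (dec-false (i ℕ.≟ k) i≢k)

q^-low : ∀ k → q^ k ∣ q^ k
q^-low k i i<k = q^-≢ (ℕ.<⇒≢ i<k)

≈-from-shift : ∀ k {f g} → (∀ i → i < k → f i ≡ g i) → (∀ n → f (k ℕ.+ n) ≡ g (k ℕ.+ n)) → f ≈ g
≈-from-shift k {f} {g} low high n with k ℕ.≤? n
... | yes k≤n = subst (λ m → f m ≡ g m) (ℕ.m+[n∸m]≡n k≤n) (high (n ∸ k))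
... | no  k≰n = low n (ℕ.≰⇒> k≰n)

q^-+ : ∀ j k → q^ (j ℕ.+ k) ≈ q^ j * q^ k
q^-+ j k = ≈-from-shift j
  (λ i i<j → trans (q^-low (j ℕ.+ k) i (ℕ.<-≤-trans i<j (ℕ.m≤m+n j k))) (sym (q^∣q^* j (q^ k) i i<j)))
  (λ n → trans (cancel j n) (sym (q^*-shift j (q^ k) n)))
  where
  cancel : ∀ j n → q^ (j ℕ.+ k) (j ℕ.+ n) ≡ q^ k n
  cancel zero    n = refl
  cancel (suc j) n = cancel j n

-- Limits

infix 4 _⟶_

-- Convergence in the q-adic topology. The bound serves all degrees up to n at once, because a
-- coefficient of a product involves all lower coefficients of its factors.
record _⟶_ (F : ℕ → PowerSeries) (L : PowerSeries) : Set where
  constructor lim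
  field
    agree : ∀ n → ∃[ M ] (∀ N → M ≤ N → F N ≈[ n ] L)

open _⟶_

⟶-unique : ∀ {F L L′} → F ⟶ L → F ⟶ L′ → L ≈ L′
⟶-unique (lim p) (lim r) n with p n | r n
... | M , F≈ | M′ , F≈′ = trans (sym (F≈ (M ℕ.⊔ M′) (ℕ.m≤m⊔n M M′) n ℕ.≤-refl))
                                 (F≈′ (M ℕ.⊔ M′) (ℕ.m≤n⊔m M M′) n ℕ.≤-refl)

⟶-const : ∀ L → (λ _ → L) ⟶ L
⟶-const L = lim λ n → 0 , λ _ _ _ _ → refl

⟶-cong : ∀ {F F′ L} → (∀ N → F N ≈ F′ N) → F ⟶ L → F′ ⟶ L
⟶-cong F≈ (lim p) = lim λ n → let (M , r) = p n in
  M , λ N M≤N i i≤n → trans (sym (F≈ N i)) (r N M≤N i i≤n)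

⟶-zip : ∀ {F G L M} (_∙_ : PowerSeries → PowerSeries → PowerSeries) →
        (∀ {f f′ g g′ n} → f ≈[ n ] f′ → g ≈[ n ] g′ → (f ∙ g) ≈[ n ] (f′ ∙ g′)) →
        F ⟶ L → G ⟶ M → (λ N → F N ∙ G N) ⟶ (L ∙ M)
⟶-zip {F} {G} {L} {M} _∙_ ∙-cong (lim p) (lim r) = lim λ n →
  let (a , F≈) = p n ; (b , G≈) = r n in
  a ℕ.⊔ b , λ N a⊔b≤N → ∙-cong {F N} {L} {G N} {M}
    (F≈ N (ℕ.m⊔n≤o⇒m≤o a b a⊔b≤N)) (G≈ N (ℕ.m⊔n≤o⇒n≤o a b a⊔b≤N))

⟶-+ : ∀ {F G L M} → F ⟶ L → G ⟶ M → (λ N → F N + G N) ⟶ L + M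
⟶-+ = ⟶-zip _+_ λ f≈ g≈ i i≤n → cong₂ ℚ._+_ (f≈ i i≤n) (g≈ i i≤n)

⟶-minus : ∀ {F G L M} → F ⟶ L → G ⟶ M → (λ N → F N - G N) ⟶ L - M
⟶-minus = ⟶-zip _-_ λ f≈ g≈ i i≤n → cong₂ ℚ._-_ (f≈ i i≤n) (g≈ i i≤n)

⟶-* : ∀ {F G L M} → F ⟶ L → G ⟶ M → (λ N → F N * G N) ⟶ L * M
⟶-* = ⟶-zip _*_ λ {f} {f′} {g} {g′} → *-cong-≈[] {f} {f′} {g} {g′}

⟶-subsequence : ∀ {F L} (s : ℕ → ℕ) → (∀ N → N ≤ s N) → F ⟶ L → (F ∘ s) ⟶ L
⟶-subsequence s N≤sN (lim p) = lim λ n → let (M , r) = p n in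
  M , λ N M≤N → r (s N) (ℕ.≤-trans M≤N (N≤sN N))

⟶-shift : ∀ {F L} k → (λ N → F (k ℕ.+ N)) ⟶ L → F ⟶ L
⟶-shift {F} k (lim p) = lim λ n → let (M , r) = p n in
  M ℕ.+ k , λ N M+k≤N → subst (λ m → F m ≈[ n ] _)
    (ℕ.m+[n∸m]≡n (ℕ.m+n≤o⇒n≤o M M+k≤N))
    (r (N ∸ k) (ℕ.m+n≤o⇒m≤o∸n M M+k≤N))

⟶-zero : ∀ {F} → (∀ N → q^ N ∣ F N) → F ⟶ 0#
⟶-zero F∣ = lim λ n → suc n , λ N n<N i i≤n → F∣ N i (ℕ.≤-<-trans i≤n n<N)

-- Infinite sums and products

partialSum : (ℕ → PowerSeries) → ℕ → PowerSeries
partialSum φ zero    = 0#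
partialSum φ (suc N) = partialSum φ N + φ N

partialSum-Fin : ∀ φ N n → ∑.sum {N} (λ i → φ (toℕ i) n) ≡ partialSum φ N n
partialSum-Fin φ zero    n = refl
partialSum-Fin φ (suc N) n = begin
  ∑.sum {suc N} (λ i → φ (toℕ i) n)
    ≡⟨ ∑.sum-init-last {N} (λ i → φ (toℕ i) n) ⟩
  ∑.sum {N} (λ i → φ (toℕ (Fin.inject₁ i)) n) ℚ.+ φ (toℕ (Fin.fromℕ N)) n
    ≡⟨ cong₂ ℚ._+_ (∑.sum-cong-≗ {N} λ i → cong (λ k → φ k n) (toℕ-inject₁ i)) (cong (λ k → φ k n) (toℕ-fromℕ N)) ⟩
  ∑.sum {N} (λ i → φ (toℕ i) n) ℚ.+ φ N n
    ≡⟨ cong (ℚ._+ φ N n) (partialSum-Fin φ N n) ⟩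
  partialSum φ N n ℚ.+ φ N n ∎
  where
  open ≡-Reasoning

≈[]-stable : ∀ (F : ℕ → PowerSeries) → (∀ N → F (suc N) ≈[ N ] F N) → ∀ {N M i} → i ≤ N → N ℕ.≤′ M → F M i ≡ F N i
≈[]-stable F step i≤N (ℕ.≤′-reflexive refl)  = refl
≈[]-stable F step {i = i} i≤N (ℕ.≤′-step {M} N≤M) =
  trans (step M i (ℕ.≤-trans i≤N (ℕ.≤′⇒≤ N≤M))) (≈[]-stable F step i≤N N≤M)

-- Infinite products and `gf∞` read the coefficient of q^n off the n-th truncation. As later
-- truncations do not change degrees up to N, this diagonal is a genuine limit.
⟶-diagonal : ∀ (F : ℕ → PowerSeries) → (∀ N → F (suc N) ≈[ N ] F N) → F ⟶ (λ n → F n n)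
⟶-diagonal F step = lim λ n → n , λ N n≤N i i≤n →
  ≈[]-stable F step ℕ.≤-refl (ℕ.≤⇒≤′ (ℕ.≤-trans i≤n n≤N))

-- Meant for `φ s` divisible by q^s, with s starting at 0: the term `φ n` may still reach the
-- coefficient of q^n, hence `suc n` terms.
series : (ℕ → PowerSeries) → PowerSeries
series φ n = partialSum φ (suc n) n

+-cancelled : ∀ {x y} → y ≡ 0ℚ → x ℚ.+ y ≡ x
+-cancelled {x} refl = ℚ.+-identityʳ x

⟶-series : ∀ φ → (∀ s → q^ s ∣ φ s) → partialSum φ ⟶ series φ
⟶-series φ φ∣ = ⟶-shift 1 (⟶-diagonal (partialSum φ ∘ suc) λ N i i≤N → +-cancelled (φ∣ (suc N) i (s≤s i≤N)))

⟶-∑∞ : ∀ F → (∀ s → q^ (suc s) ∣ F (suc s)) → partialSum (F ∘ suc) ⟶ ∑∞ F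
⟶-∑∞ F F∣ = lim λ n → let (M , r) = agree (⟶-diagonal (partialSum (F ∘ suc)) λ N i i≤N → +-cancelled (F∣ N i (s≤s i≤N))) n in
  M , λ N M≤N i i≤n → trans (r N M≤N i i≤n) (sym (partialSum-Fin (F ∘ suc) i i))

⟶-∏∞ : ∀ F → (∀ N → F (suc N) ≈[ N ] 1#) → (λ N → ∏ N F) ⟶ ∏∞ F
⟶-∏∞ F F≈1 = ⟶-diagonal (λ N → ∏ N F) λ N i i≤N →
  trans (*-cong-≈[] {∏ N F} {∏ N F} {F (suc N)} {1#} (λ _ _ → refl) (F≈1 N) i i≤N) (PS.*-identityʳ (∏ N F) i)

partialSum-cong : ∀ {φ ψ} → (∀ s → φ s ≈ ψ s) → ∀ N → partialSum φ N ≈ partialSum ψ N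
partialSum-cong φ≈ zero    n = refl
partialSum-cong φ≈ (suc N) n = cong₂ ℚ._+_ (partialSum-cong φ≈ N n) (φ≈ N n)

partialSum-+ : ∀ φ ψ N → partialSum (λ s → φ s + ψ s) N ≈ partialSum φ N + partialSum ψ N
partialSum-+ φ ψ zero    n = refl
partialSum-+ φ ψ (suc N) = ≈-trans (+-congʳ (φ N + ψ N) (partialSum-+ φ ψ N))
  (Solver.solve 4 (λ a b c d → a :+ b :+ (c :+ d) := a :+ c :+ (b :+ d)) PS.≈-refl (partialSum φ N) (partialSum ψ N) (φ N) (ψ N))
  where open Solver

partialSum-* : ∀ c φ N → partialSum (λ s → c * φ s) N ≈ c * partialSum φ N
partialSum-* c φ zero    = ≈-sym (PS.zeroʳ c)
partialSum-* c φ (suc N) = ≈-trans (+-congʳ (c * φ N) (partialSum-* c φ N)) (≈-sym (*-distribˡ c (partialSum φ N) (φ N)))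

partialSum-telescope : ∀ (u : ℕ → PowerSeries) N → partialSum (λ s → u (suc s) - u s) N ≈ u N - u 0
partialSum-telescope u zero    n = sym (ℚ.+-inverseʳ (u 0 n))
partialSum-telescope u (suc N) = ≈-trans (+-congʳ (u (suc N) - u N) (partialSum-telescope u N))
  (Solver.solve 3 (λ a b c → a :- b :+ (c :- a) := c :- b) PS.≈-refl (u N) (u 0) (u (suc N)))
  where open Solver

partialSum-suc : ∀ φ N → partialSum φ (suc N) ≈ φ 0 + partialSum (φ ∘ suc) N
partialSum-suc φ zero    n = ℚ.+-comm 0ℚ (φ 0 n)
partialSum-suc φ (suc N) = ≈-trans (+-congʳ (φ (suc N)) (partialSum-suc φ N)) (PS.+-assoc (φ 0) (partialSum (φ ∘ suc) N) (φ (suc N)))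

q^∣-* : ∀ k {f g} → f 0 ≡ 0ℚ → q^ k ∣ g → q^ suc k ∣ (f * g)
q^∣-* k {f} {g} f0 g∣ i (s≤s i≤k) with i
... | zero  = trans (ℚ.+-identityʳ _) (trans (cong (ℚ._* g 0) f0) (ℚ.*-zeroˡ (g 0)))
... | suc j = trans (cong₂ ℚ._+_ (trans (cong (ℚ._* g (suc j)) f0) (ℚ.*-zeroˡ (g (suc j))))
                (trans (*-cong-≤ {tail f} {tail f} {g} {0#} j (λ _ _ → refl) (λ l l≤j → g∣ l (ℕ.≤-<-trans l≤j i≤k))) (PS.zeroʳ (tail f) j)))
              (ℚ.+-identityˡ 0ℚ)

q^∣-^ : ∀ {f} → f 0 ≡ 0ℚ → ∀ k → q^ k ∣ (f ^ k)
q^∣-^ f0 zero    i ()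
q^∣-^ {f} f0 (suc k) = q^∣-* k {f} {f ^ k} f0 (q^∣-^ f0 k)

-- With g = 1 - f, the product of f and 1 + g + ... + g^(N-1) is 1 - g^N, and g^N tends to 0 because
-- g has no constant term.
*-inverseʳ : ∀ f → f 0 ≡ 1ℚ → f * inverse₁ f ≈ 1#
*-inverseʳ f f0≡1 = ⟶-unique
  (⟶-* (⟶-const f) (lim λ n → let (M , r) = agree (⟶-series (g ^_) (q^∣-^ g0)) n in
      M , λ N M≤N i i≤n → trans (r N M≤N i i≤n) (sym (partialSum-Fin (g ^_) (suc i) i))))
  (⟶-cong (λ N → ≈-sym (geometric N))
    (lim λ n → let (M , r) = agree (⟶-minus (⟶-const 1#) (⟶-zero (q^∣-^ g0))) n in
      M , λ N M≤N i i≤n → trans (r N M≤N i i≤n) (+-cancelled refl)))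
  where
  g : PowerSeries
  g = 1# - f
  g0 : g 0 ≡ 0ℚ
  g0 = trans (cong (λ x → 1ℚ ℚ.- x) f0≡1) (ℚ.+-inverseʳ 1ℚ)
  geometric : ∀ N → f * partialSum (g ^_) N ≈ 1# - g ^ N
  geometric zero    = ≈-trans (PS.zeroʳ f) (λ n → sym (ℚ.+-inverseʳ (1# n)))
  geometric (suc N) = ≈-trans (*-distribˡ f (partialSum (g ^_) N) (g ^ N)) (≈-trans (+-congʳ (f * g ^ N) (geometric N))
    (Solver.solve 2 (λ f x → con 1ℚ :- x :+ f :* x := con 1ℚ :- (con 1ℚ :- f) :* x) PS.≈-refl f (g ^ N)))
    where open Solver

*-cancelˡ : ∀ f {g h} → f 0 ≡ 1ℚ → f * g ≈ f * h → g ≈ h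
*-cancelˡ f {g} {h} f0≡1 fg≈fh = ≈-trans (≈-sym (undo g)) (≈-trans (*-congˡ (inverse₁ f) fg≈fh) (undo h))
  where
  undo : ∀ g → inverse₁ f * (f * g) ≈ g
  undo g = ≈-trans (Solver.solve 3 (λ i f g → i :* (f :* g) := (f :* i) :* g) PS.≈-refl (inverse₁ f) f g)
    (≈-trans (*-congʳ g (*-inverseʳ f f0≡1)) (*-identityˡ g))
    where open Solver

-- Rational functions

∑-zero : ∀ {n} (t : Fin n → ℚ) → (∀ i → t i ≡ 0ℚ) → ∑.sum t ≡ 0ℚ
∑-zero {n} t t≡0 = trans (∑.sum-cong-≗ t≡0) (∑.sum-replicate-zero n)

polynomial-0# : IsPolynomial 0#
polynomial-0# = 0 , λ _ _ → refl

polynomial-q^ : ∀ k → IsPolynomial (q^ k)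
polynomial-q^ k = suc k , λ n k<n → q^-≢ (ℕ.>⇒≢ k<n)

polynomial-1# : IsPolynomial 1#
polynomial-1# = polynomial-q^ 0

polynomial-+ : ∀ {f g} → IsPolynomial f → IsPolynomial g → IsPolynomial (f + g)
polynomial-+ (M , p) (N , r) = M ℕ.⊔ N , λ n M⊔N≤n →
  cong₂ ℚ._+_ (p n (ℕ.m⊔n≤o⇒m≤o M N M⊔N≤n)) (r n (ℕ.m⊔n≤o⇒n≤o M N M⊔N≤n))

polynomial-minus : ∀ {f g} → IsPolynomial f → IsPolynomial g → IsPolynomial (f - g)
polynomial-minus (M , p) (N , r) = M ℕ.⊔ N , λ n M⊔N≤n →
  cong₂ ℚ._-_ (p n (ℕ.m⊔n≤o⇒m≤o M N M⊔N≤n)) (r n (ℕ.m⊔n≤o⇒n≤o M N M⊔N≤n))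

polynomial-* : ∀ {f g} → IsPolynomial f → IsPolynomial g → IsPolynomial (f * g)
polynomial-* {f} {g} (M , p) (N , r) = M ℕ.+ N , λ n M+N≤n → ∑-zero {suc n} _ λ i → term n (toℕ i) M+N≤n
  where
  term : ∀ n i → M ℕ.+ N ≤ n → f i ℚ.* g (n ∸ i) ≡ 0ℚ
  term n i M+N≤n with M ℕ.≤? i
  ... | yes M≤i = trans (cong (ℚ._* g (n ∸ i)) (p i M≤i)) (ℚ.*-zeroˡ (g (n ∸ i)))
  ... | no  M≰i = trans (cong (f i ℚ.*_) (r (n ∸ i)
          (ℕ.m+n≤o⇒m≤o∸n N (ℕ.≤-trans (ℕ.+-monoʳ-≤ N (ℕ.<⇒≤ (ℕ.≰⇒> M≰i))) (subst (_≤ n) (ℕ.+-comm M N) M+N≤n)))))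
        (ℚ.*-zeroʳ (f i))

-- Normalising the denominator's constant term to 1 gives closure under sums and products
-- without appealing to ℚ[[q]] being a domain.
record Rational (R : PowerSeries) : Set where
  field
    numerator denominator  : PowerSeries
    numerator-polynomial   : IsPolynomial numerator
    denominator-polynomial : IsPolynomial denominator
    denominator-0          : denominator 0 ≡ 1ℚ
    quotient               : denominator * R ≈ numerator

open Rational

Rational⇒IsRational : ∀ {R} → Rational R → IsRational R
Rational⇒IsRational r = numerator r , denominator r , numerator-polynomial r , denominator-polynomial r
  , (λ Q≈0 → 1≢0 (trans (sym (denominator-0 r)) (Q≈0 0))) , quotient r
  where
  1≢0 : 1ℚ ≢ 0ℚ
  1≢0 ()

rational-≈ : ∀ {R S} → R ≈ S → Rational R → Rational S
rational-≈ {R} {S} R≈S r = record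
  { numerator-polynomial   = numerator-polynomial r
  ; denominator-polynomial = denominator-polynomial r
  ; denominator-0          = denominator-0 r
  ; quotient               = ≈-trans (*-congˡ (denominator r) (≈-sym R≈S)) (quotient r)
  }

rational-polynomial : ∀ {P} → IsPolynomial P → Rational P
rational-polynomial {P} p = record
  { numerator-polynomial   = p
  ; denominator-polynomial = polynomial-1#
  ; denominator-0          = refl
  ; quotient               = *-identityˡ P
  }

*-0 : ∀ {f g} → f 0 ≡ 1ℚ → g 0 ≡ 1ℚ → (f * g) 0 ≡ 1ℚ
*-0 f0 g0 = trans (ℚ.+-identityʳ _) (cong₂ ℚ._*_ f0 g0)

rational-+ : ∀ {R S} → Rational R → Rational S → Rational (R + S)
rational-+ {R} {S} r s = record
  { numerator-polynomial   = polynomial-+ (polynomial-* (denominator-polynomial s) (numerator-polynomial r))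
                                          (polynomial-* (denominator-polynomial r) (numerator-polynomial s))
  ; denominator-polynomial = polynomial-* (denominator-polynomial r) (denominator-polynomial s)
  ; denominator-0          = *-0 {denominator r} {denominator s} (denominator-0 r) (denominator-0 s)
  ; quotient               = ≈-trans
      (Solver.solve 4 (λ p q r s → (p :* q) :* (r :+ s) := q :* (p :* r) :+ p :* (q :* s)) PS.≈-refl
        (denominator r) (denominator s) R S)
      (+-cong (*-congˡ (denominator s) (quotient r)) (*-congˡ (denominator r) (quotient s)))
  }
  where open Solver

rational-* : ∀ {R S} → Rational R → Rational S → Rational (R * S)
rational-* {R} {S} r s = record
  { numerator-polynomial   = polynomial-* (numerator-polynomial r) (numerator-polynomial s)
  ; denominator-polynomial = polynomial-* (denominator-polynomial r) (denominator-polynomial s)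
  ; denominator-0          = *-0 {denominator r} {denominator s} (denominator-0 r) (denominator-0 s)
  ; quotient               = ≈-trans
      (Solver.solve 4 (λ p q r s → (p :* q) :* (r :* s) := (p :* r) :* (q :* s)) PS.≈-refl
        (denominator r) (denominator s) R S)
      (*-cong {denominator r * R} {numerator r} {denominator s * S} {numerator s} (quotient r) (quotient s))
  }
  where open Solver

rational-0# : Rational 0#
rational-0# = rational-polynomial polynomial-0#

rational-1# : Rational 1#
rational-1# = rational-polynomial polynomial-1#

rational-q^ : ∀ k → Rational (q^ k)
rational-q^ k = rational-polynomial (polynomial-q^ k)

rational-constant : ∀ c → Rational (constant c)
rational-constant c = rational-polynomial (1 , λ { (suc n) _ → refl })

rational-minus : ∀ {R S} → Rational R → Rational S → Rational (R - S)
rational-minus {R} {S} r s = rational-≈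
  (Solver.solve 2 (λ r s → r :+ con (ℚ.- 1ℚ) :* s := r :- s) PS.≈-refl R S)
  (rational-+ r (rational-* (rational-constant (ℚ.- 1ℚ)) s))
  where open Solver

rational-divide : ∀ f {R} → IsPolynomial f → f 0 ≡ 1ℚ → Rational (f * R) → Rational R
rational-divide f {R} f-poly f0≡1 r = record
  { numerator-polynomial   = numerator-polynomial r
  ; denominator-polynomial = polynomial-* (denominator-polynomial r) f-poly
  ; denominator-0          = *-0 {denominator r} {f} (denominator-0 r) f0≡1
  ; quotient               = ≈-trans (*-assoc (denominator r) f R) (quotient r)
  }

-- Moving `q^ k` into the denominator would spoil its constant term 1. The numerator is itself
-- `q^ k` times a series, so it is shifted down instead.
rational-divide-q^ : ∀ k {R} → Rational (q^ k * R) → Rational R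
rational-divide-q^ k {R} r = record
  { numerator              = λ n → numerator r (k ℕ.+ n)
  ; numerator-polynomial   = let (N , p) = numerator-polynomial r in
                             N , λ n N≤n → p (k ℕ.+ n) (ℕ.≤-trans N≤n (ℕ.m≤n+m n k))
  ; denominator-polynomial = denominator-polynomial r
  ; denominator-0          = denominator-0 r
  ; quotient               = λ n → trans (sym (q^*-shift k (denominator r * R) n))
      (trans (Solver.solve 3 (λ q d r → q :* (d :* r) := d :* (q :* r)) PS.≈-refl (q^ k) (denominator r) R (k ℕ.+ n))
             (quotient r (k ℕ.+ n)))
  }
  where open Solver

rational-inverse₁ : ∀ f → IsPolynomial f → f 0 ≡ 1ℚ → Rational (inverse₁ f)
rational-inverse₁ f f-poly f0≡1 = rational-divide f f-poly f0≡1 (rational-≈ (≈-sym (*-inverseʳ f f0≡1)) rational-1#)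

rational-divide-1-q^ : ∀ k {R} → Rational ((1# - q^ (suc k)) * R) → Rational R
rational-divide-1-q^ k = rational-divide (1# - q^ (suc k)) (polynomial-minus polynomial-1# (polynomial-q^ (suc k))) refl

rational-divide-q^-q^ : ∀ l k {R} → Rational ((q^ l - q^ (l ℕ.+ suc k)) * R) → Rational R
rational-divide-q^-q^ l k {R} r = rational-divide-1-q^ k (rational-divide-q^ l (rational-≈ rearrange r))
  where
  open Solver
  rearrange : (q^ l - q^ (l ℕ.+ suc k)) * R ≈ q^ l * ((1# - q^ (suc k)) * R)
  rearrange = ≈-trans (*-congʳ R (minus-congˡ (q^ l) (q^-+ l (suc k))))
    (Solver.solve 3 (λ l k r → (l :- l :* k) :* r := l :* ((con 1ℚ :- k) :* r)) PS.≈-refl (q^ l) (q^ (suc k)) R)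

-- The sums arising from partitions into distinct parts

y : ℕ → PowerSeries
y j = inverse₁ (1# + q^ j)

*-y : ∀ j → (1# + q^ (suc j)) * y (suc j) ≈ 1#
*-y j = *-inverseʳ (1# + q^ (suc j)) refl

rational-y : ∀ j → Rational (y (suc j))
rational-y j = rational-inverse₁ (1# + q^ (suc j)) (polynomial-+ polynomial-1# (polynomial-q^ (suc j))) refl

y⟶1 : (λ N → y (suc N)) ⟶ 1#
y⟶1 = lim λ n → let (M , r) = _⟶_.agree (⟶-minus (⟶-const 1#) (⟶-zero q^∣)) n in
  M , λ N M≤N i i≤n → trans (expand N i) (trans (r N M≤N i i≤n) (ℚ.+-identityʳ (1# i)))
  where
  open Solver
  q^∣ : ∀ N → q^ N ∣ (q^ (suc N) * y (suc N))
  q^∣ N i i<N = q^∣q^* (suc N) (y (suc N)) i (ℕ.m<n⇒m<1+n i<N)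
  expand : ∀ N → y (suc N) ≈ 1# - q^ (suc N) * y (suc N)
  expand N = ≈-trans
    (solve 2 (λ q y → y := (con 1ℚ :+ q) :* y :- q :* y) PS.≈-refl (q^ (suc N)) (y (suc N)))
    (minus-cong {g = q^ (suc N) * y (suc N)} (*-y N) (λ _ → refl))

-- Π_{m=0}^{a} 1/(1+q^{j+m})
Y : ℕ → ℕ → PowerSeries
Y j zero    = y j
Y j (suc a) = Y j a * y (j ℕ.+ suc a)

Y-left : ∀ j a → Y j (suc a) ≈ y j * Y (suc j) a
Y-left j zero    rewrite ℕ.+-comm j 1 = λ _ → refl
Y-left j (suc a) rewrite ℕ.+-suc j (suc a) =
  ≈-trans (*-congʳ (y (suc (j ℕ.+ suc a))) (Y-left j a)) (*-assoc (y j) (Y (suc j) a) (y (suc (j ℕ.+ suc a))))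

Y-cancelˡ : ∀ j a → (1# + q^ (suc j)) * Y (suc j) (suc a) ≈ Y (suc (suc j)) a
Y-cancelˡ j a = begin
  (1# + q^ (suc j)) * Y (suc j) (suc a)              ≈⟨ *-congˡ (1# + q^ (suc j)) (Y-left (suc j) a) ⟩
  (1# + q^ (suc j)) * (y (suc j) * Y (suc (suc j)) a) ≈⟨ *-assoc (1# + q^ (suc j)) (y (suc j)) (Y (suc (suc j)) a) ⟨
  (1# + q^ (suc j)) * y (suc j) * Y (suc (suc j)) a   ≈⟨ *-congʳ (Y (suc (suc j)) a) (*-y j) ⟩
  1# * Y (suc (suc j)) a                             ≈⟨ *-identityˡ (Y (suc (suc j)) a) ⟩
  Y (suc (suc j)) a                                  ∎
  where open ≈-Reasoning

Y-cancelʳ : ∀ j a → (1# + q^ (suc j ℕ.+ suc a)) * Y (suc j) (suc a) ≈ Y (suc j) a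
Y-cancelʳ j a = begin
  (1# + q^ (suc j ℕ.+ suc a)) * (Y (suc j) a * y (suc j ℕ.+ suc a))
    ≈⟨ solve 3 (λ p r y → p :* (r :* y) := (p :* y) :* r) PS.≈-refl (1# + q^ (suc j ℕ.+ suc a)) (Y (suc j) a) (y (suc j ℕ.+ suc a)) ⟩
  (1# + q^ (suc j ℕ.+ suc a)) * y (suc j ℕ.+ suc a) * Y (suc j) a
    ≈⟨ *-congʳ (Y (suc j) a) (*-y (j ℕ.+ suc a)) ⟩
  1# * Y (suc j) a
    ≈⟨ *-identityˡ (Y (suc j) a) ⟩
  Y (suc j) a ∎
  where
  open ≈-Reasoning
  open Solver

rational-Y : ∀ j a → Rational (Y (suc j) a)
rational-Y j zero    = rational-y j
rational-Y j (suc a) = rational-* (rational-Y j a) (rational-y (j ℕ.+ suc a))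

Y⟶1 : ∀ a → (λ N → Y (suc N) a) ⟶ 1#
Y⟶1 zero    = y⟶1
Y⟶1 (suc a) = lim λ n → let (M , r) = _⟶_.agree (⟶-* (Y⟶1 a) (⟶-subsequence (ℕ._+ suc a) (λ N → ℕ.m≤m+n N (suc a)) y⟶1)) n in
  M , λ N M≤N i i≤n → trans (r N M≤N i i≤n) (*-identityˡ 1# i)

u : ℕ → ℕ → ℕ → PowerSeries
u l a j = q^ (j ℕ.* l) * Y j a

rational-u : ∀ l a j → Rational (u l a (suc j))
rational-u l a j = rational-* (rational-q^ (suc j ℕ.* l)) (rational-Y j a)

u-suc : ∀ l a j → u (suc l) a j ≈ q^ j * (q^ (j ℕ.* l) * Y j a)
u-suc l a j = ≈-trans (*-congʳ (Y j a) (≈-trans (λ n → cong (λ k → q^ k n) (ℕ.*-suc j l)) (q^-+ j (j ℕ.* l))))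
  (*-assoc (q^ j) (q^ (j ℕ.* l)) (Y j a))

module _ (l a i : ℕ) where
  private
    j = suc i
    Y′ = Y j (suc a)
    X = q^ (j ℕ.* l)

  u≈ : u l a j ≈ X * ((1# + q^ j * q^ (suc a)) * Y′)
  u≈ = *-congˡ X (≈-trans (≈-sym (Y-cancelʳ i a)) (*-congʳ Y′ (+-congˡ 1# (q^-+ j (suc a)))))

  u-next≈ : u l a (suc j) ≈ (q^ l * X) * ((1# + q^ j) * Y′)
  u-next≈ = *-cong {q^ (suc j ℕ.* l)} {q^ l * X} {Y (suc j) a} {(1# + q^ j) * Y′} (q^-+ l (j ℕ.* l)) (≈-sym (Y-cancelˡ i a))

  -- Put x = q^j. Over the common factor `X * Y′` the difference is q^l (1 + x) - (1 + x q^(a+1)),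
  -- and its constant and linear parts in x are the two terms on the right.
  u-difference : u l a (suc j) - u l a j ≈ (q^ l - 1#) * u l (suc a) j + (q^ l - q^ (suc a)) * u (suc l) (suc a) j
  u-difference = begin
    u l a (suc j) - u l a j
      ≈⟨ minus-cong u-next≈ u≈ ⟩
    (q^ l * X) * ((1# + q^ j) * Y′) - X * ((1# + q^ j * q^ (suc a)) * Y′)
      ≈⟨ solve 5 (λ L X x A Y → (L :* X) :* ((con 1ℚ :+ x) :* Y) :- X :* ((con 1ℚ :+ x :* A) :* Y)
                   := (L :- con 1ℚ) :* (X :* Y) :+ (L :- A) :* (x :* (X :* Y))) PS.≈-refl (q^ l) X (q^ j) (q^ (suc a)) Y′ ⟩
    (q^ l - 1#) * (X * Y′) + (q^ l - q^ (suc a)) * (q^ j * (X * Y′))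
      ≈⟨ +-congˡ ((q^ l - 1#) * (X * Y′)) (*-congˡ (q^ l - q^ (suc a)) (u-suc l (suc a) j)) ⟨
    (q^ l - 1#) * u l (suc a) j + (q^ l - q^ (suc a)) * u (suc l) (suc a) j ∎
    where
    open ≈-Reasoning
    open Solver

  -- Writing x q^(a+1) as (1 + x q^(a+1)) - 1 cancels the last denominator in one of the two terms.
  -- Unlike the telescoping relation this keeps a nonzero coefficient when l = a + 1.
  u-diagonal : q^ (suc a) * u (suc l) (suc a) j ≈ u l a j - u l (suc a) j
  u-diagonal = begin
    q^ (suc a) * u (suc l) (suc a) j
      ≈⟨ *-congˡ (q^ (suc a)) (u-suc l (suc a) j) ⟩
    q^ (suc a) * (q^ j * (X * Y′))
      ≈⟨ solve 4 (λ X x A Y → A :* (x :* (X :* Y)) := X :* ((con 1ℚ :+ x :* A) :* Y) :- X :* Y) PS.≈-refl X (q^ j) (q^ (suc a)) Y′ ⟩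
    X * ((1# + q^ j * q^ (suc a)) * Y′) - X * Y′
      ≈⟨ minus-cong {g = X * Y′} u≈ (λ _ → refl) ⟨
    u l a j - u l (suc a) j ∎
    where
    open ≈-Reasoning
    open Solver

∑u : ℕ → ℕ → ℕ → PowerSeries
∑u l a = partialSum (λ s → u l a (suc s))

-- Σ_{j≥1} q^{j(l+1)} / ((1+q^j)⋯(1+q^{j+a}))
T : ℕ → ℕ → PowerSeries
T l a = series (λ s → u (suc l) a (suc s))

q^∣u : ∀ l a s → q^ suc s ∣ u (suc l) a (suc s)
q^∣u l a s i i<s = q^∣q^* (suc s ℕ.* suc l) (Y (suc s) a) i (ℕ.<-≤-trans i<s (ℕ.m≤m*n (suc s) (suc l)))

∑u⟶T : ∀ l a → ∑u (suc l) a ⟶ T l a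
∑u⟶T l a = ⟶-series (λ s → u (suc l) a (suc s)) λ s i i<s → q^∣u l a s i (ℕ.m<n⇒m<1+n i<s)

∑u-telescope : ∀ l a N → u l a (suc N) - u l a 1 ≈ (q^ l - 1#) * ∑u l (suc a) N + (q^ l - q^ (suc a)) * ∑u (suc l) (suc a) N
∑u-telescope l a N = begin
  u l a (suc N) - u l a 1
    ≈⟨ partialSum-telescope (λ s → u l a (suc s)) N ⟨
  partialSum (λ s → u l a (suc (suc s)) - u l a (suc s)) N
    ≈⟨ partialSum-cong (u-difference l a) N ⟩
  partialSum (λ s → (q^ l - 1#) * u l (suc a) (suc s) + (q^ l - q^ (suc a)) * u (suc l) (suc a) (suc s)) N
    ≈⟨ partialSum-+ (λ s → (q^ l - 1#) * u l (suc a) (suc s)) (λ s → (q^ l - q^ (suc a)) * u (suc l) (suc a) (suc s)) N ⟩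
  partialSum (λ s → (q^ l - 1#) * u l (suc a) (suc s)) N + partialSum (λ s → (q^ l - q^ (suc a)) * u (suc l) (suc a) (suc s)) N
    ≈⟨ +-cong (partialSum-* (q^ l - 1#) (λ s → u l (suc a) (suc s)) N)
              (partialSum-* (q^ l - q^ (suc a)) (λ s → u (suc l) (suc a) (suc s)) N) ⟩
  (q^ l - 1#) * ∑u l (suc a) N + (q^ l - q^ (suc a)) * ∑u (suc l) (suc a) N ∎
  where open ≈-Reasoning

u-zero⟶1 : ∀ a → (λ N → u 0 a (suc N)) ⟶ 1#
u-zero⟶1 a = ⟶-cong (λ N → ≈-sym (≈-trans (*-congʳ (Y (suc N) a) (λ n → cong (λ k → q^ k n) (ℕ.*-zeroʳ (suc N)))) (*-identityˡ (Y (suc N) a)))) (Y⟶1 a)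

u-suc⟶0 : ∀ l a → (λ N → u (suc l) a (suc N)) ⟶ 0#
u-suc⟶0 l a = ⟶-zero λ s i i<s → q^∣u l a s i (ℕ.m<n⇒m<1+n i<s)

-- In the limit of `∑u-telescope` the boundary term at infinity tends to 1 for exponent 0 and to 0
-- otherwise. What remains relates two sums of the same arm length and consecutive l, and l < a
-- makes the leading coefficient invertible up to a power of q.
rational-T : ∀ l a → l < a → Rational (T l a)
rational-T zero (suc a) _ = rational-divide-1-q^ a (rational-≈ identity (rational-minus rational-1# (rational-u 0 a 0)))
  where
  open Solver
  identity : 1# - u 0 a 1 ≈ (1# - q^ (suc a)) * T 0 (suc a)
  identity = ⟶-unique (⟶-minus (u-zero⟶1 a) (⟶-const (u 0 a 1)))
    (⟶-cong (λ N → ≈-sym (≈-trans (∑u-telescope 0 a N)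
      -- The factor q^0 - 1 removes `∑u 0 (suc a) N`, whose terms tend to 1 and which therefore has
      -- no limit.
      (solve 3 (λ z A t → (con 1ℚ :- con 1ℚ) :* z :+ (con 1ℚ :- A) :* t := (con 1ℚ :- A) :* t) PS.≈-refl (∑u 0 (suc a) N) (q^ (suc a)) (∑u 1 (suc a) N))))
    (⟶-* (⟶-const (1# - q^ (suc a))) (∑u⟶T 0 (suc a))))
-- The leading coefficient is q^(l+1) (1 - q^(a-l)), where a - l is `suc (a ∸ suc l)`.
rational-T (suc l) (suc a) (s≤s l<a) = rational-divide-q^-q^ (suc l) (a ∸ suc l)
  (rational-≈ identity′
    (rational-minus (rational-minus rational-0# (rational-u (suc l) a 0))
      (rational-* (rational-minus (rational-q^ (suc l)) rational-1#) (rational-T l (suc a) (ℕ.m<n⇒m<1+n l<a)))))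
  where
  open Solver
  C = q^ (suc l) - 1#
  D = q^ (suc l) - q^ (suc a)
  identity : 0# - u (suc l) a 1 ≈ C * T l (suc a) + D * T (suc l) (suc a)
  identity = ⟶-unique (⟶-minus (u-suc⟶0 l a) (⟶-const (u (suc l) a 1)))
    (⟶-cong (λ N → ≈-sym (∑u-telescope (suc l) a N))
    (⟶-+ (⟶-* (⟶-const C) (∑u⟶T l (suc a))) (⟶-* (⟶-const D) (∑u⟶T (suc l) (suc a)))))
  exponent : suc a ≡ suc l ℕ.+ suc (a ∸ suc l)
  exponent = sym (trans (ℕ.+-suc (suc l) (a ∸ suc l)) (cong suc (ℕ.m+[n∸m]≡n l<a)))
  identity′ : 0# - u (suc l) a 1 - C * T l (suc a) ≈ (q^ (suc l) - q^ (suc l ℕ.+ suc (a ∸ suc l))) * T (suc l) (suc a)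
  identity′ = begin
    0# - u (suc l) a 1 - C * T l (suc a)
      ≈⟨ minus-cong {g = C * T l (suc a)} identity (λ _ → refl) ⟩
    C * T l (suc a) + D * T (suc l) (suc a) - C * T l (suc a)
      ≈⟨ solve 2 (λ x z → x :+ z :- x := z) PS.≈-refl (C * T l (suc a)) (D * T (suc l) (suc a)) ⟩
    D * T (suc l) (suc a)
      ≈⟨ *-congʳ (T (suc l) (suc a)) (minus-congˡ (q^ (suc l)) (λ n → cong (λ k → q^ k n) exponent)) ⟩
    (q^ (suc l) - q^ (suc l ℕ.+ suc (a ∸ suc l))) * T (suc l) (suc a) ∎
    where open ≈-Reasoning

T00≈S : T 0 0 ≈ ∑q^k/⟨1+q^k⟩
T00≈S = ⟶-unique (∑u⟶T 0 0)
  (⟶-cong (partialSum-cong λ s → *-congʳ (y (suc s)) (λ n → cong (λ k → q^ k n) (sym (ℕ.*-identityʳ (suc s)))))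
    (⟶-∑∞ (λ k → q^ k * y k) (λ s → q^∣q^* (suc s) (y (suc s)))))

T-diagonal : ∀ a → q^ (suc a) * T (suc a) (suc a) ≈ T a a - T a (suc a)
T-diagonal a = ⟶-unique (⟶-* (⟶-const (q^ (suc a))) (∑u⟶T (suc a) (suc a)))
  (⟶-cong (λ N → ≈-sym (sums N)) (⟶-minus (∑u⟶T a a) (∑u⟶T a (suc a))))
  where
  open ≈-Reasoning
  open Solver
  sums : ∀ N → q^ (suc a) * ∑u (suc (suc a)) (suc a) N ≈ ∑u (suc a) a N - ∑u (suc a) (suc a) N
  sums zero    = ≈-trans (PS.zeroʳ (q^ (suc a))) (λ _ → refl)
  sums (suc N) = begin
    q^ (suc a) * (∑u (suc (suc a)) (suc a) N + u (suc (suc a)) (suc a) (suc N))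
      ≈⟨ *-distribˡ (q^ (suc a)) (∑u (suc (suc a)) (suc a) N) (u (suc (suc a)) (suc a) (suc N)) ⟩
    q^ (suc a) * ∑u (suc (suc a)) (suc a) N + q^ (suc a) * u (suc (suc a)) (suc a) (suc N)
      ≈⟨ +-cong (sums N) (u-diagonal (suc a) a N) ⟩
    ∑u (suc a) a N - ∑u (suc a) (suc a) N + (u (suc a) a (suc N) - u (suc a) (suc a) (suc N))
      ≈⟨ solve 4 (λ a b c d → a :- b :+ (c :- d) := a :+ c :- (b :+ d)) PS.≈-refl
           (∑u (suc a) a N) (∑u (suc a) (suc a) N) (u (suc a) a (suc N)) (u (suc a) (suc a) (suc N)) ⟩
    ∑u (suc a) a N + u (suc a) a (suc N) - (∑u (suc a) (suc a) N + u (suc a) (suc a) (suc N)) ∎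

-- The elementary symmetric polynomial of degree l in 1, q, …, q^{a-1}.
ε : ℕ → ℕ → PowerSeries
ε zero    zero    = 1#
ε zero    (suc l) = 0#
ε (suc a) zero    = ε a zero
ε (suc a) (suc l) = ε a (suc l) + q^ a * ε a l

rational-ε : ∀ a l → Rational (ε a l)
rational-ε zero    zero    = rational-1#
rational-ε zero    (suc l) = rational-0#
rational-ε (suc a) zero    = rational-ε a zero
rational-ε (suc a) (suc l) = rational-+ (rational-ε a (suc l)) (rational-* (rational-q^ a) (rational-ε a l))

ε-vanishes : ∀ a l → a < l → ε a l ≈ 0#
ε-vanishes zero    (suc l) _         = λ _ → refl
ε-vanishes (suc a) (suc l) (s≤s a<l) = ≈-trans
  (+-cong (ε-vanishes a (suc l) (ℕ.m<n⇒m<1+n a<l)) (≈-trans (*-congˡ (q^ a) (ε-vanishes a l a<l)) (PS.zeroʳ (q^ a))))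
  (λ _ → ℚ.+-identityʳ 0ℚ)

-- The share of the boxes with arm a and leg l after division by the infinite product. The row of
-- the box has length j + a: its q^a stands here, while its q^j makes the exponent in `T l a` equal
-- to j (l + 1).
Z : ℕ → ℕ → PowerSeries
Z a l = q^ a * ε a l * T l a

rational-Z : ∀ a l → a ≢ l → Rational (Z a l)
rational-Z a l a≢l with ℕ.<-cmp a l
... | tri< a<l _ _ = rational-≈ (≈-sym (≈-trans (*-congʳ (T l a) (≈-trans (*-congˡ (q^ a) (ε-vanishes a l a<l)) (PS.zeroʳ (q^ a)))) (*-zeroˡ (T l a)))) rational-0#
... | tri≈ _ a≡l _ with () ← a≢l a≡l
... | tri> _ _ l<a = rational-* (rational-* (rational-q^ a) (rational-ε a l)) (rational-T l a l<a)

-- Since `ε a (suc a)` vanishes, `ε (suc a) (suc a)` is q^a times `ε a a`. The remaining q^(a+1) is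
-- just what `T-diagonal` consumes, so passing from a to a + 1 changes `Z a a` only by a rational
-- multiple of the off-diagonal `T a (suc a)`.
rational-Z-S : ∀ a → Rational (Z a a - ∑q^k/⟨1+q^k⟩)
rational-Z-S zero    = rational-≈ (≈-sym identity) rational-0#
  where
  open ≈-Reasoning
  open Solver
  identity : 1# * 1# * T 0 0 - ∑q^k/⟨1+q^k⟩ ≈ 0#
  identity = begin
    1# * 1# * T 0 0 - ∑q^k/⟨1+q^k⟩
      ≈⟨ minus-congˡ (1# * 1# * T 0 0) (≈-sym T00≈S) ⟩
    1# * 1# * T 0 0 - T 0 0
      ≈⟨ solve 1 (λ t → con 1ℚ :* con 1ℚ :* t :- t := con 0ℚ) PS.≈-refl (T 0 0) ⟩
    constant 0ℚ
      ≈⟨ (λ { zero → refl ; (suc n) → refl }) ⟩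
    0# ∎
rational-Z-S (suc a) = rational-≈ (≈-sym identity)
  (rational-minus (rational-Z-S a) (rational-* (rational-* (rational-q^ a) (rational-ε a a)) (rational-T a (suc a) (ℕ.n<1+n a))))
  where
  open ≈-Reasoning
  open Solver
  S = ∑q^k/⟨1+q^k⟩
  identity : Z (suc a) (suc a) - S ≈ Z a a - S - q^ a * ε a a * T a (suc a)
  identity = begin
    q^ (suc a) * (ε a (suc a) + q^ a * ε a a) * T (suc a) (suc a) - S
      ≈⟨ minus-cong {g = S} (*-congʳ (T (suc a) (suc a)) (*-congˡ (q^ (suc a)) (+-congʳ (q^ a * ε a a) (ε-vanishes a (suc a) (ℕ.n<1+n a))))) (λ _ → refl) ⟩
    q^ (suc a) * (0# + q^ a * ε a a) * T (suc a) (suc a) - S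
      ≈⟨ minus-cong {g = S} (*-congʳ (T (suc a) (suc a)) (*-congˡ (q^ (suc a)) (PS.+-identityˡ (q^ a * ε a a)))) (λ _ → refl) ⟩
    q^ (suc a) * (q^ a * ε a a) * T (suc a) (suc a) - S
      ≈⟨ solve 4 (λ A e t s → A :* e :* t :- s := e :* (A :* t) :- s) PS.≈-refl (q^ (suc a)) (q^ a * ε a a) (T (suc a) (suc a)) S ⟩
    q^ a * ε a a * (q^ (suc a) * T (suc a) (suc a)) - S
      ≈⟨ minus-cong {g = S} (*-congˡ (q^ a * ε a a) (T-diagonal a)) (λ _ → refl) ⟩
    q^ a * ε a a * (T a a - T a (suc a)) - S
      ≈⟨ solve 4 (λ e t t′ s → e :* (t :- t′) :- s := e :* t :- s :- e :* t′) PS.≈-refl (q^ a * ε a a) (T a a) (T a (suc a)) S ⟩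
    Z a a - S - q^ a * ε a a * T a (suc a) ∎

-- Weighted enumeration of partitions

private variable
  ℓ ℓ′ : Level
  A B : Set ℓ

partitions≤-small : ∀ m n → n < suc m → partitions≤ (suc m) n ≡ partitions≤ m n
partitions≤-small m n n≤m rewrite m<n⇒m/n≡0 n≤m = trans (List.++-identityʳ _) (List.map-id (partitions≤ m n))

-- Multiplicity 0 of the largest size gives the first list. In the others one copy is peeled off,
-- and the range of multiplicities shrinks by one because (m+1+n)/(m+1) = 1 + n/(m+1).
partitions≤-large : ∀ m n → partitions≤ (suc m) (suc m ℕ.+ n)
                          ≡ partitions≤ m (suc m ℕ.+ n) ++ map (suc m ∷_) (partitions≤ (suc m) n)
partitions≤-large m n rewrite m/n≡1+[m∸n]/n {suc m ℕ.+ n} {suc m} (ℕ.m≤m+n (suc m) n) | ℕ.m+n∸m≡n m n =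
  cong₂ _++_ (List.map-id (partitions≤ m (suc m ℕ.+ n))) (begin
    concatMap (part (suc m ℕ.+ n)) (applyUpTo suc k)
      ≡⟨ cong (concatMap (part (suc m ℕ.+ n))) (List.map-upTo suc k) ⟨
    concatMap (part (suc m ℕ.+ n)) (map suc (upTo k))
      ≡⟨ List.concatMap-map (part (suc m ℕ.+ n)) suc (upTo k) ⟩
    concatMap (λ c → part (suc m ℕ.+ n) (suc c)) (upTo k)
      ≡⟨ List.concatMap-cong peel (upTo k) ⟩
    concatMap (λ c → map (suc m ∷_) (part n c)) (upTo k)
      ≡⟨ List.map-concatMap (suc m ∷_) (part n) (upTo k) ⟨
    map (suc m ∷_) (partitions≤ (suc m) n) ∎)
  where
  open ≡-Reasoning
  k = suc (n ℕ./ suc m)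
  part : ℕ → ℕ → List (List ℕ)
  part n c = map (replicate c (suc m) ++_) (partitions≤ m (n ∸ c ℕ.* suc m))
  peel : ∀ c → part (suc m ℕ.+ n) (suc c) ≡ map (suc m ∷_) (part n c)
  peel c = trans
    (cong (λ r → map (replicate (suc c) (suc m) ++_) (partitions≤ m r)) (ℕ.[m+n]∸[m+o]≡n∸o (suc m) n (c ℕ.* suc m)))
    (List.map-∘ (partitions≤ m (n ∸ c ℕ.* suc m)))

parts-bounded : ∀ m n → All (All (_≤ m)) (partitions≤ m n)
parts-bounded zero    zero    = [] ∷ []
parts-bounded zero    (suc n) = []
parts-bounded (suc m) n       = All.concat⁺ (All.map⁺ (All.universal (λ c → All.map⁺ (All.map
  (λ p → All.++⁺ (All.replicate⁺ c ℕ.≤-refl) (All.map ℕ.m≤n⇒m≤1+n p))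
  (parts-bounded m (n ∸ c ℕ.* suc m)))) (upTo (suc (n ℕ./ suc m)))))

total : (A → ℚ) → List A → ℚ
total w []       = 0ℚ
total w (x ∷ xs) = w x ℚ.+ total w xs

total-++ : ∀ (w : A → ℚ) xs ys → total w (xs ++ ys) ≡ total w xs ℚ.+ total w ys
total-++ w []       ys = sym (ℚ.+-identityˡ (total w ys))
total-++ w (x ∷ xs) ys = trans (cong (w x ℚ.+_) (total-++ w xs ys)) (sym (ℚ.+-assoc (w x) (total w xs) (total w ys)))

total-map : ∀ (w : B → ℚ) (f : A → B) xs → total w (map f xs) ≡ total (w ∘ f) xs
total-map w f []       = refl
total-map w f (x ∷ xs) = cong (w (f x) ℚ.+_) (total-map w f xs)

total-cong : ∀ {w w′ : A → ℚ} {xs} → All (λ x → w x ≡ w′ x) xs → total w xs ≡ total w′ xs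
total-cong []       = refl
total-cong (p ∷ ps) = cong₂ ℚ._+_ p (total-cong ps)

total-zero : ∀ (xs : List A) → total (λ _ → 0ℚ) xs ≡ 0ℚ
total-zero []       = refl
total-zero (x ∷ xs) = trans (ℚ.+-identityˡ (total (λ _ → 0ℚ) xs)) (total-zero xs)

total-+ : ∀ (w w′ : A → ℚ) xs → total (λ x → w x ℚ.+ w′ x) xs ≡ total w xs ℚ.+ total w′ xs
total-+ w w′ []       = refl
total-+ w w′ (x ∷ xs) = trans (cong (w x ℚ.+ w′ x ℚ.+_) (total-+ w w′ xs))
  (solve 4 (λ a b c d → a :+ b :+ (c :+ d) := a :+ c :+ (b :+ d)) refl (w x) (w′ x) (total w xs) (total w′ xs))
  where open +-*-Solver

Weight : Set
Weight = List ℕ → ℚ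

gf : ℕ → Weight → PowerSeries
gf m w n = total w (partitions≤ m n)

-- The bound on the parts is essential: a new largest part preserves distinctness, and parts of size
-- at most s leave a leg empty, only because of it.
gf-cong : ∀ m {w w′} → (∀ λ′ → All (_≤ m) λ′ → w λ′ ≡ w′ λ′) → gf m w ≈ gf m w′
gf-cong m w≡ n = total-cong (All.map (w≡ _) (parts-bounded m n))

gf-0 : ∀ m → gf m (λ _ → 0ℚ) ≈ 0#
gf-0 m n = total-zero (partitions≤ m n)

gf-+ : ∀ m w w′ → gf m (λ λ′ → w λ′ ℚ.+ w′ λ′) ≈ gf m w + gf m w′
gf-+ m w w′ n = total-+ w w′ (partitions≤ m n)

gf-zero : ∀ w → w [] ≡ 1ℚ → gf 0 w ≈ 1#
gf-zero w w≡1 zero    = cong (ℚ._+ 0ℚ) w≡1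
gf-zero w w≡1 (suc n) = refl

gf-suc : ∀ m w → gf (suc m) w ≈ gf m w + q^ (suc m) * gf (suc m) (w ∘ (suc m ∷_))
gf-suc m w = ≈-from-shift (suc m)
  (λ i i<m → trans (cong (total w) (partitions≤-small m i i<m))
    (sym (+-cancelled (q^∣q^* (suc m) (gf (suc m) (w ∘ (suc m ∷_))) i i<m))))
  (λ n → trans (cong (total w) (partitions≤-large m n))
    (trans (total-++ w (partitions≤ m (suc m ℕ.+ n)) (map (suc m ∷_) (partitions≤ (suc m) n)))
      (cong (total w (partitions≤ m (suc m ℕ.+ n)) ℚ.+_)
        (trans (total-map w (suc m ∷_) (partitions≤ (suc m) n)) (sym (q^*-shift (suc m) (gf (suc m) (w ∘ (suc m ∷_))) n))))))

gf∞ : Weight → PowerSeries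
gf∞ w n = gf n w n

-- A partition of n has no part above n, so raising the bound beyond n leaves its list unchanged.
gf⟶gf∞ : ∀ w → (λ m → gf m w) ⟶ gf∞ w
gf⟶gf∞ w = ⟶-diagonal (λ m → gf m w) λ m n n≤m → cong (total w) (partitions≤-small m n (s≤s n≤m))

𝟙 : {P : Set ℓ} → Dec P → ℚ
𝟙 P? = if does P? then 1ℚ else 0ℚ

𝟙-true : {P : Set ℓ} (P? : Dec P) → P → 𝟙 P? ≡ 1ℚ
𝟙-true P? p = cong (λ b → if b then 1ℚ else 0ℚ) (dec-true P? p)

𝟙-false : {P : Set ℓ} (P? : Dec P) → ¬ P → 𝟙 P? ≡ 0ℚ
𝟙-false P? ¬p = cong (λ b → if b then 1ℚ else 0ℚ) (dec-false P? ¬p)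

𝟙-⇔ : {P : Set ℓ} {Q : Set ℓ′} (P? : Dec P) (Q? : Dec Q) → (P → Q) → (Q → P) → 𝟙 P? ≡ 𝟙 Q?
𝟙-⇔ P? Q? f g = cong (λ b → if b then 1ℚ else 0ℚ) (does-⇔ (mk⇔ f g) P? Q?)

-- A hook number is arm + leg + 1, so hook number k + 1 corresponds to the pairs with a + l = k. The
-- operation is a parameter so that one definition serves both counts and series.
antidiagonal : (A → A → A) → ℕ → (ℕ → ℕ → A) → A
antidiagonal _∙_ zero    V = V 0 0
antidiagonal _∙_ (suc k) V = V 0 (suc k) ∙ antidiagonal _∙_ k (V ∘ suc)

∑ℚ : ℕ → (ℕ → ℕ → ℚ) → ℚ
∑ℚ = antidiagonal ℚ._+_

∑ᵖ : ℕ → (ℕ → ℕ → PowerSeries) → PowerSeries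
∑ᵖ = antidiagonal _+_

∑ᵖ-coefficient : ∀ k V n → ∑ᵖ k V n ≡ ∑ℚ k (λ a l → V a l n)
∑ᵖ-coefficient zero    V n = refl
∑ᵖ-coefficient (suc k) V n = cong (V 0 (suc k) n ℚ.+_) (∑ᵖ-coefficient k (V ∘ suc) n)

∑ℚ-cong : ∀ k {V W} → (∀ a l → V a l ≡ W a l) → ∑ℚ k V ≡ ∑ℚ k W
∑ℚ-cong zero    V≡W = V≡W 0 0
∑ℚ-cong (suc k) V≡W = cong₂ ℚ._+_ (V≡W 0 (suc k)) (∑ℚ-cong k (V≡W ∘ suc))

∑ℚ-zero : ∀ k → ∑ℚ k (λ _ _ → 0ℚ) ≡ 0ℚ
∑ℚ-zero zero    = refl
∑ℚ-zero (suc k) = trans (ℚ.+-identityˡ (∑ℚ k (λ _ _ → 0ℚ))) (∑ℚ-zero k)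

∑ℚ-+ : ∀ k V W → ∑ℚ k (λ a l → V a l ℚ.+ W a l) ≡ ∑ℚ k V ℚ.+ ∑ℚ k W
∑ℚ-+ zero    V W = refl
∑ℚ-+ (suc k) V W = trans (cong (V 0 (suc k) ℚ.+ W 0 (suc k) ℚ.+_) (∑ℚ-+ k (V ∘ suc) (W ∘ suc)))
  (solve 4 (λ a b c d → a :+ b :+ (c :+ d) := a :+ c :+ (b :+ d)) refl
    (V 0 (suc k)) (W 0 (suc k)) (∑ℚ k (V ∘ suc)) (∑ℚ k (W ∘ suc)))
  where open +-*-Solver

∑ℚ-* : ∀ k c V → ∑ℚ k (λ a l → c ℚ.* V a l) ≡ c ℚ.* ∑ℚ k V
∑ℚ-* zero    c V = refl
∑ℚ-* (suc k) c V = trans (cong (c ℚ.* V 0 (suc k) ℚ.+_) (∑ℚ-* k c (V ∘ suc))) (sym (ℚ.*-distribˡ-+ c (V 0 (suc k)) (∑ℚ k (V ∘ suc))))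

∑ᵖ-cong : ∀ k {V W} → (∀ a l → V a l ≈ W a l) → ∑ᵖ k V ≈ ∑ᵖ k W
∑ᵖ-cong zero    V≈W = V≈W 0 0
∑ᵖ-cong (suc k) V≈W = +-cong (V≈W 0 (suc k)) (∑ᵖ-cong k (V≈W ∘ suc))

∑ᵖ-* : ∀ k c V → ∑ᵖ k (λ a l → c * V a l) ≈ c * ∑ᵖ k V
∑ᵖ-* zero    c V n = refl
∑ᵖ-* (suc k) c V = ≈-trans (+-congˡ (c * V 0 (suc k)) (∑ᵖ-* k c (V ∘ suc))) (≈-sym (*-distribˡ c (V 0 (suc k)) (∑ᵖ k (V ∘ suc))))

∑ᵖ-last : ∀ k V → ∑ᵖ (suc k) V ≈ ∑ᵖ k (λ a l → V a (suc l)) + V (suc k) 0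
∑ᵖ-last zero    V n = refl
∑ᵖ-last (suc k) V = ≈-trans (+-congˡ (V 0 (suc (suc k))) (∑ᵖ-last k (V ∘ suc)))
  (≈-sym (PS.+-assoc (V 0 (suc (suc k))) (∑ᵖ k (λ a l → V (suc a) (suc l))) (V (suc (suc k)) 0)))

-- Hook lengths as arm and leg lengths

ι : ℕ → ℚ
ι n = + n ℚ./ 1

ι-+ : ∀ m n → ι (m ℕ.+ n) ≡ ι m ℚ.+ ι n
ι-+ m n = ℚ.toℚᵘ-injective (begin
  ℚ.toℚᵘ (ι (m ℕ.+ n))                     ≈⟨ ℚ.toℚᵘ-fromℚᵘ (ℚᵘ.mkℚᵘ (+ (m ℕ.+ n)) 0) ⟩
  ℚᵘ.mkℚᵘ (+ (m ℕ.+ n)) 0                  ≈⟨ ℚᵘ.*≡* (cong (ℤ._* (+ 1)) (sym (cong₂ ℤ._+_ (ℤ.*-identityʳ (+ m)) (ℤ.*-identityʳ (+ n))))) ⟩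
  ℚᵘ.mkℚᵘ (+ m) 0 ℚᵘ.+ ℚᵘ.mkℚᵘ (+ n) 0     ≈⟨ ℚᵘ.+-cong (ℚ.toℚᵘ-fromℚᵘ (ℚᵘ.mkℚᵘ (+ m) 0)) (ℚ.toℚᵘ-fromℚᵘ (ℚᵘ.mkℚᵘ (+ n) 0)) ⟨
  ℚ.toℚᵘ (ι m) ℚᵘ.+ ℚ.toℚᵘ (ι n)           ≈⟨ ℚ.toℚᵘ-homo-+ (ι m) (ι n) ⟨
  ℚ.toℚᵘ (ι m ℚ.+ ι n)                     ∎)
  where open SetoidReasoning ℚᵘ.≃-setoid

ι-length-filter : {P : A → Set ℓ} (P? : Decidable P) → ∀ xs → ι (length (filter P? xs)) ≡ total (λ x → 𝟙 (P? x)) xs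
ι-length-filter P? []       = refl
ι-length-filter P? (x ∷ xs) with ih ← ι-length-filter P? xs | does (P? x)
... | true  = trans (ι-+ 1 (length (filter P? xs))) (cong (1ℚ ℚ.+_) ih)
... | false = trans ih (sym (ℚ.+-identityˡ (total (λ x → 𝟙 (P? x)) xs)))

ι-sum-filter : {P : A → Set ℓ} (P? : Decidable P) (f : A → ℕ) → ∀ xs →
               ι (sum (map f (filter P? xs))) ≡ total (λ x → 𝟙 (P? x) ℚ.* ι (f x)) xs
ι-sum-filter P? f []       = refl
ι-sum-filter P? f (x ∷ xs) with ih ← ι-sum-filter P? f xs | does (P? x)
... | true  = trans (ι-+ (f x) (sum (map f (filter P? xs)))) (cong₂ ℚ._+_ (sym (ℚ.*-identityˡ (ι (f x)))) ih)
... | false = trans ih (sym (trans (cong (ℚ._+ rest) (ℚ.*-zeroˡ (ι (f x)))) (ℚ.+-identityˡ rest)))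
  where rest = total (λ x → 𝟙 (P? x) ℚ.* ι (f x)) xs

parts≥ : ℕ → List ℕ → ℕ
parts≥ t xs = length (filter (t ℕ.≤?_) xs)

-- The number of boxes with arm length a and leg length l.
boxes : ℕ → ℕ → Weight
boxes a l []       = 0ℚ
boxes a l (x ∷ xs) = 𝟙 (a ℕ.<? x) ℚ.* 𝟙 (parts≥ (x ∸ a) xs ℕ.≟ l) ℚ.+ boxes a l xs

-- Induction on the row length. The last column has arm 0; deleting it lowers every other hook
-- number in the row by one, which matches the shift from `V` to `V ∘ suc`. The function `g` holds
-- the legs fixed while the row shrinks.
row-hooks : ∀ (g : ℕ → ℕ) k x →
            total (λ j → 𝟙 ((1 ℕ.+ (x ∸ suc j) ℕ.+ g (suc j)) ℕ.≟ suc k)) (upTo x)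
            ≡ ∑ℚ k (λ a l → 𝟙 (a ℕ.<? x) ℚ.* 𝟙 (g (x ∸ a) ℕ.≟ l))
row-hooks g k zero    = sym (trans (∑ℚ-cong k (λ a l → ℚ.*-zeroˡ (𝟙 (g (0 ∸ a) ℕ.≟ l)))) (∑ℚ-zero k))
row-hooks g k (suc x) = begin
  total hook (upTo (suc x))
    ≡⟨ cong (total hook) (List.upTo-∷ʳ x) ⟨
  total hook (upTo x ++ [ x ])
    ≡⟨ total-++ hook (upTo x) [ x ] ⟩
  total hook (upTo x) ℚ.+ (hook x ℚ.+ 0ℚ)
    ≡⟨ cong₂ ℚ._+_ (total-cong (All.map shorter (All.all-upTo x))) (trans (ℚ.+-identityʳ (hook x)) last) ⟩
  total (λ j → 𝟙 ((1 ℕ.+ (x ∸ suc j) ℕ.+ g (suc j)) ℕ.≟ k)) (upTo x) ℚ.+ V 0 k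
    ≡⟨ recurse k ⟩
  ∑ℚ k V ∎
  where
  open ≡-Reasoning
  hook : ℕ → ℚ
  hook j = 𝟙 ((1 ℕ.+ (suc x ∸ suc j) ℕ.+ g (suc j)) ℕ.≟ suc k)
  V : ℕ → ℕ → ℚ
  V a l = 𝟙 (a ℕ.<? suc x) ℚ.* 𝟙 (g (suc x ∸ a) ℕ.≟ l)
  shorter : ∀ {j} → j < x → hook j ≡ 𝟙 ((1 ℕ.+ (x ∸ suc j) ℕ.+ g (suc j)) ℕ.≟ k)
  shorter {j} j<x = cong (λ r → 𝟙 ((r ℕ.+ g (suc j)) ℕ.≟ k)) (ℕ.+-∸-assoc 1 j<x)
  last : hook x ≡ V 0 k
  last = trans (cong (λ r → 𝟙 ((r ℕ.+ g (suc x)) ℕ.≟ k)) (ℕ.n∸n≡0 x)) (sym (ℚ.*-identityˡ (𝟙 (g (suc x) ℕ.≟ k))))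
  recurse : ∀ k → total (λ j → 𝟙 ((1 ℕ.+ (x ∸ suc j) ℕ.+ g (suc j)) ℕ.≟ k)) (upTo x) ℚ.+ V 0 k ≡ ∑ℚ k V
  -- The other columns would need hook number 0 in the shortened row, but hook numbers are
  -- successors.
  recurse zero    = trans (cong (ℚ._+ V 0 0) (total-zero (upTo x))) (ℚ.+-identityˡ (V 0 0))
  recurse (suc k) = trans (ℚ.+-comm _ (V 0 (suc k))) (cong (V 0 (suc k) ℚ.+_) (row-hooks g k x))

hookCount-boxes : ∀ k λ′ → ι (hookCount (suc k) λ′) ≡ ∑ℚ k (λ a l → boxes a l λ′)
hookCount-boxes k []       = sym (∑ℚ-zero k)
hookCount-boxes k (x ∷ xs) = begin
  ι (length (filter (ℕ._≟ suc k) (row ++ hookNumbers xs)))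
    ≡⟨ ι-length-filter (ℕ._≟ suc k) (row ++ hookNumbers xs) ⟩
  total (λ h → 𝟙 (h ℕ.≟ suc k)) (row ++ hookNumbers xs)
    ≡⟨ total-++ _ row (hookNumbers xs) ⟩
  total (λ h → 𝟙 (h ℕ.≟ suc k)) row ℚ.+ total (λ h → 𝟙 (h ℕ.≟ suc k)) (hookNumbers xs)
    ≡⟨ cong₂ ℚ._+_ (trans (total-map _ hook (upTo x)) (row-hooks (λ t → parts≥ t xs) k x))
                   (trans (sym (ι-length-filter (ℕ._≟ suc k) (hookNumbers xs))) (hookCount-boxes k xs)) ⟩
  ∑ℚ k (λ a l → 𝟙 (a ℕ.<? x) ℚ.* 𝟙 (parts≥ (x ∸ a) xs ℕ.≟ l)) ℚ.+ ∑ℚ k (λ a l → boxes a l xs)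
    ≡⟨ ∑ℚ-+ k _ (λ a l → boxes a l xs) ⟨
  ∑ℚ k (λ a l → boxes a l (x ∷ xs)) ∎
  where
  open ≡-Reasoning
  hook : ℕ → ℕ
  hook j = 1 ℕ.+ (x ∸ suc j) ℕ.+ parts≥ (suc j) xs
  row : List ℕ
  row = map hook (upTo x)

total-∑ℚ : ∀ k (w : A → ℚ) (V : ℕ → ℕ → A → ℚ) xs →
           total (λ x → w x ℚ.* ∑ℚ k (λ a l → V a l x)) xs ≡ ∑ℚ k (λ a l → total (λ x → w x ℚ.* V a l x) xs)
total-∑ℚ k w V []       = sym (∑ℚ-zero k)
total-∑ℚ k w V (x ∷ xs) = trans
  (cong₂ ℚ._+_ (sym (∑ℚ-* k (w x) (λ a l → V a l x))) (total-∑ℚ k w V xs))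
  (sym (∑ℚ-+ k (λ a l → w x ℚ.* V a l x) (λ a l → total (λ x → w x ℚ.* V a l x) xs)))

hook-series : {P : List ℕ → Set ℓ} (P? : Decidable P) → ∀ k n →
              ι (sum (map (hookCount (suc k)) (filter P? (partitions n))))
              ≡ ∑ᵖ k (λ a l → gf∞ (λ λ′ → 𝟙 (P? λ′) ℚ.* boxes a l λ′)) n
hook-series P? k n = begin
  ι (sum (map (hookCount (suc k)) (filter P? (partitions n))))
    ≡⟨ ι-sum-filter P? (hookCount (suc k)) (partitions n) ⟩
  total (λ λ′ → 𝟙 (P? λ′) ℚ.* ι (hookCount (suc k) λ′)) (partitions n)
    ≡⟨ total-cong (All.universal (λ λ′ → cong (𝟙 (P? λ′) ℚ.*_) (hookCount-boxes k λ′)) (partitions n)) ⟩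
  total (λ λ′ → 𝟙 (P? λ′) ℚ.* ∑ℚ k (λ a l → boxes a l λ′)) (partitions n)
    ≡⟨ total-∑ℚ k (λ λ′ → 𝟙 (P? λ′)) boxes (partitions n) ⟩
  ∑ℚ k (λ a l → gf∞ (λ λ′ → 𝟙 (P? λ′) ℚ.* boxes a l λ′) n)
    ≡⟨ ∑ᵖ-coefficient k (λ a l → gf∞ (λ λ′ → 𝟙 (P? λ′) ℚ.* boxes a l λ′)) n ⟨
  ∑ᵖ k (λ a l → gf∞ (λ λ′ → 𝟙 (P? λ′) ℚ.* boxes a l λ′)) n ∎
  where open ≡-Reasoning

boxes-vanish : ∀ a l λ′ → All (_≤ a) λ′ → boxes a l λ′ ≡ 0ℚ
boxes-vanish a l []       []         = refl
boxes-vanish a l (x ∷ xs) (x≤a ∷ ps) = trans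
  (cong₂ ℚ._+_ (trans (cong (ℚ._* 𝟙 (parts≥ (x ∸ a) xs ℕ.≟ l)) (𝟙-false (a ℕ.<? x) (ℕ.≤⇒≯ x≤a))) (ℚ.*-zeroˡ (𝟙 (parts≥ (x ∸ a) xs ℕ.≟ l)))) (boxes-vanish a l xs ps))
  (ℚ.+-identityˡ 0ℚ)

boxes-top : ∀ a l s xs → boxes a l (suc (a ℕ.+ s) ∷ xs) ≡ 𝟙 (parts≥ (suc s) xs ℕ.≟ l) ℚ.+ boxes a l xs
boxes-top a l s xs = cong (ℚ._+ boxes a l xs) (trans
  (cong₂ (λ x t → x ℚ.* 𝟙 (parts≥ t xs ℕ.≟ l)) (𝟙-true (a ℕ.<? suc (a ℕ.+ s)) (s≤s (ℕ.m≤m+n a s)))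
    (trans (cong (_∸ a) (sym (ℕ.+-suc a s))) (ℕ.m+n∸m≡n a (suc s))))
  (ℚ.*-identityˡ (𝟙 (parts≥ (suc s) xs ℕ.≟ l))))

parts≥-none : ∀ s xs → All (_≤ s) xs → parts≥ (suc s) xs ≡ 0
parts≥-none s xs ps = cong length (List.filter-none (suc s ℕ.≤?_) (All.map ℕ.≤⇒≯ ps))

parts≥-cons : ∀ {t x} xs → t ≤ x → parts≥ t (x ∷ xs) ≡ suc (parts≥ t xs)
parts≥-cons {t} xs t≤x = cong length (List.filter-accept (t ℕ.≤?_) t≤x)

-- Partitions into distinct parts

infixl 7 _·_

_·_ : Weight → Weight → Weight
(w · w′) λ′ = w λ′ ℚ.* w′ λ′

gf-·-+ : ∀ m w w₁ w₂ → gf m (w · (λ λ′ → w₁ λ′ ℚ.+ w₂ λ′)) ≈ gf m (w · w₁) + gf m (w · w₂)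
gf-·-+ m w w₁ w₂ = ≈-trans (gf-cong m (λ λ′ _ → ℚ.*-distribˡ-+ (w λ′) (w₁ λ′) (w₂ λ′))) (gf-+ m (w · w₁) (w · w₂))

gf-·-0 : ∀ m w {w′} → (∀ λ′ → All (_≤ m) λ′ → w′ λ′ ≡ 0ℚ) → gf m (w · w′) ≈ 0#
gf-·-0 m w w′≡0 = ≈-trans (gf-cong m (λ λ′ p → trans (cong (w λ′ ℚ.*_) (w′≡0 λ′ p)) (ℚ.*-zeroʳ (w λ′)))) (gf-0 m)

one : Weight
one _ = 1ℚ

legs : ℕ → ℕ → Weight
legs t l λ′ = 𝟙 (parts≥ t λ′ ℕ.≟ l)

legs-none : ∀ s λ′ → All (_≤ s) λ′ → legs (suc s) 0 λ′ ≡ 1ℚ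
legs-none s λ′ p = 𝟙-true (parts≥ (suc s) λ′ ℕ.≟ 0) (parts≥-none s λ′ p)

legs-some : ∀ s l λ′ → All (_≤ s) λ′ → legs (suc s) (suc l) λ′ ≡ 0ℚ
legs-some s l λ′ p = 𝟙-false (parts≥ (suc s) λ′ ℕ.≟ suc l) λ eq → ℕ.0≢1+n (trans (sym (parts≥-none s λ′ p)) eq)

legs-cons-zero : ∀ {t x} λ′ → t ≤ x → legs t 0 (x ∷ λ′) ≡ 0ℚ
legs-cons-zero {t} {x} λ′ t≤x = 𝟙-false (parts≥ t (x ∷ λ′) ℕ.≟ 0) λ eq → ℕ.0≢1+n (trans (sym eq) (parts≥-cons λ′ t≤x))

legs-cons-suc : ∀ {t x} l λ′ → t ≤ x → legs t (suc l) (x ∷ λ′) ≡ legs t l λ′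
legs-cons-suc l λ′ t≤x = cong (λ c → 𝟙 (c ℕ.≟ suc l)) (parts≥-cons λ′ t≤x)

distinct : Weight
distinct λ′ = 𝟙 (unique? λ′)

distinct-repeat : ∀ x λ′ → distinct (x ∷ x ∷ λ′) ≡ 0ℚ
distinct-repeat x λ′ = 𝟙-false (unique? (x ∷ x ∷ λ′)) λ { ((x≢x ∷ _) ∷ _) → x≢x refl }

distinct-new : ∀ m λ′ → All (_≤ m) λ′ → distinct (suc m ∷ λ′) ≡ distinct λ′
distinct-new m λ′ p = 𝟙-⇔ (unique? (suc m ∷ λ′)) (unique? λ′) (λ { (_ ∷ u) → u })
  (λ u → All.map (λ x≤m → ℕ.>⇒≢ (s≤s x≤m)) p ∷ u)

-- The recursion `gf-suc` is applied twice: a second copy of `suc m` has weight 0, so below the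
-- first copy only parts up to m remain.
distinct-suc : ∀ m w → gf (suc m) (distinct · w) ≈ gf m (distinct · w) + q^ (suc m) * gf m (distinct · (w ∘ (suc m ∷_)))
distinct-suc m w = ≈-trans (gf-suc m (distinct · w)) (+-congˡ (gf m (distinct · w)) (*-congˡ (q^ (suc m)) (begin
  gf (suc m) w₁
    ≈⟨ gf-suc m w₁ ⟩
  gf m w₁ + q^ (suc m) * gf (suc m) (w₁ ∘ (suc m ∷_))
    ≈⟨ +-cong (gf-cong m (λ λ′ p → cong (ℚ._* w (suc m ∷ λ′)) (distinct-new m λ′ p)))
              (*-congˡ (q^ (suc m)) (≈-trans (gf-cong (suc m) twice) (gf-0 (suc m)))) ⟩
  gf m (distinct · (w ∘ (suc m ∷_))) + q^ (suc m) * 0#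
    ≈⟨ (λ n → +-cancelled (PS.zeroʳ (q^ (suc m)) n)) ⟩
  gf m (distinct · (w ∘ (suc m ∷_))) ∎)))
  where
  open ≈-Reasoning
  w₁ : Weight
  w₁ = (distinct · w) ∘ (suc m ∷_)
  twice : ∀ λ′ → All (_≤ suc m) λ′ → w₁ (suc m ∷ λ′) ≡ 0ℚ
  twice λ′ _ = trans (cong (ℚ._* w (suc m ∷ suc m ∷ λ′)) (distinct-repeat (suc m) λ′)) (ℚ.*-zeroˡ (w (suc m ∷ suc m ∷ λ′)))

P : ℕ → PowerSeries
P m = ∏ m (λ j → 1# + q^ j)

gf-distinct : ∀ m → gf m (distinct · one) ≈ P m
gf-distinct zero    = gf-zero (distinct · one) refl
gf-distinct (suc m) = begin
  gf (suc m) (distinct · one)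
    ≈⟨ distinct-suc m one ⟩
  gf m (distinct · one) + q^ (suc m) * gf m (distinct · one)
    ≈⟨ solve 2 (λ g q → g :+ q :* g := g :* (con 1ℚ :+ q)) PS.≈-refl (gf m (distinct · one)) (q^ (suc m)) ⟩
  gf m (distinct · one) * (1# + q^ (suc m))
    ≈⟨ *-congʳ (1# + q^ (suc m)) (gf-distinct m) ⟩
  P (suc m) ∎
  where
  open ≈-Reasoning
  open Solver

-- Sizes up to s are free and give `P s`. Exactly l of the sizes s+1, ..., s+i occur, each at most
-- once, and q^(s+1) is taken out of each.
distinct-legs : ∀ s i l → gf (i ℕ.+ s) (distinct · legs (suc s) l) ≈ P s * (q^ (suc s ℕ.* l) * ε i l)
distinct-legs s zero    zero    = begin
  gf s (distinct · legs (suc s) 0)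
    ≈⟨ gf-cong s (λ λ′ p → cong (distinct λ′ ℚ.*_) (legs-none s λ′ p)) ⟩
  gf s (distinct · one)
    ≈⟨ gf-distinct s ⟩
  P s
    ≈⟨ solve 1 (λ p → p := p :* (con 1ℚ :* con 1ℚ)) PS.≈-refl (P s) ⟩
  P s * (1# * 1#)
    ≈⟨ (λ n → cong (λ k → (P s * (q^ k * 1#)) n) (sym (ℕ.*-zeroʳ (suc s)))) ⟩
  P s * (q^ (suc s ℕ.* 0) * 1#) ∎
  where
  open ≈-Reasoning
  open Solver
distinct-legs s zero    (suc l) = ≈-trans (gf-·-0 s distinct (legs-some s l))
  (≈-sym (≈-trans (*-congˡ (P s) (PS.zeroʳ (q^ (suc s ℕ.* suc l)))) (PS.zeroʳ (P s))))
distinct-legs s (suc i) zero    = begin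
  gf (suc (i ℕ.+ s)) (distinct · legs (suc s) 0)
    ≈⟨ distinct-suc (i ℕ.+ s) (legs (suc s) 0) ⟩
  gf (i ℕ.+ s) (distinct · legs (suc s) 0) + q^ (suc (i ℕ.+ s)) * gf (i ℕ.+ s) (distinct · (legs (suc s) 0 ∘ (suc (i ℕ.+ s) ∷_)))
    ≈⟨ +-congˡ (gf (i ℕ.+ s) (distinct · legs (suc s) 0)) (*-congˡ (q^ (suc (i ℕ.+ s)))
         (gf-·-0 (i ℕ.+ s) distinct (λ λ′ _ → legs-cons-zero λ′ (s≤s (ℕ.m≤n+m s i))))) ⟩
  gf (i ℕ.+ s) (distinct · legs (suc s) 0) + q^ (suc (i ℕ.+ s)) * 0#
    ≈⟨ (λ n → +-cancelled (PS.zeroʳ (q^ (suc (i ℕ.+ s))) n)) ⟩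
  gf (i ℕ.+ s) (distinct · legs (suc s) 0)
    ≈⟨ distinct-legs s i zero ⟩
  P s * (q^ (suc s ℕ.* 0) * ε i 0) ∎
  where open ≈-Reasoning
distinct-legs s (suc i) (suc l) = begin
  gf (suc (i ℕ.+ s)) (distinct · legs (suc s) (suc l))
    ≈⟨ distinct-suc (i ℕ.+ s) (legs (suc s) (suc l)) ⟩
  gf (i ℕ.+ s) (distinct · legs (suc s) (suc l)) + q^ (suc (i ℕ.+ s)) * gf (i ℕ.+ s) (distinct · (legs (suc s) (suc l) ∘ (suc (i ℕ.+ s) ∷_)))
    ≈⟨ +-cong (distinct-legs s i (suc l)) (*-cong {q^ (suc (i ℕ.+ s))} {q^ i * q^ (suc s)} exponent
         (≈-trans (gf-cong (i ℕ.+ s) (λ λ′ _ → cong (distinct λ′ ℚ.*_) (legs-cons-suc l λ′ (s≤s (ℕ.m≤n+m s i))))) (distinct-legs s i l))) ⟩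
  P s * (q^ (suc s ℕ.* suc l) * ε i (suc l)) + q^ i * q^ (suc s) * (P s * (X * ε i l))
    ≈⟨ +-congʳ (q^ i * q^ (suc s) * (P s * (X * ε i l))) (*-congˡ (P s) (*-congʳ (ε i (suc l)) power)) ⟩
  P s * (q^ (suc s) * X * ε i (suc l)) + q^ i * q^ (suc s) * (P s * (X * ε i l))
    ≈⟨ solve 6 (λ p x X A e e′ → p :* (x :* X :* e′) :+ A :* x :* (p :* (X :* e)) := p :* (x :* X :* (e′ :+ A :* e)))
         PS.≈-refl (P s) (q^ (suc s)) X (q^ i) (ε i l) (ε i (suc l)) ⟩
  P s * (q^ (suc s) * X * ε (suc i) (suc l))
    ≈⟨ *-congˡ (P s) (*-congʳ (ε (suc i) (suc l)) power) ⟨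
  P s * (q^ (suc s ℕ.* suc l) * ε (suc i) (suc l)) ∎
  where
  open ≈-Reasoning
  open Solver
  X = q^ (suc s ℕ.* l)
  exponent : q^ (suc (i ℕ.+ s)) ≈ q^ i * q^ (suc s)
  exponent = ≈-trans (λ n → cong (λ k → q^ k n) (sym (ℕ.+-suc i s))) (q^-+ i (suc s))
  power : q^ (suc s ℕ.* suc l) ≈ q^ (suc s) * X
  power = ≈-trans (λ n → cong (λ k → q^ k n) (ℕ.*-suc (suc s) l)) (q^-+ (suc s) (suc s ℕ.* l))

P-Y : ∀ s a → P (suc (a ℕ.+ s)) * Y (suc s) a ≈ P s
P-Y s zero    = begin
  P s * (1# + q^ (suc s)) * y (suc s)    ≈⟨ *-assoc (P s) (1# + q^ (suc s)) (y (suc s)) ⟩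
  P s * ((1# + q^ (suc s)) * y (suc s))  ≈⟨ *-congˡ (P s) (*-y s) ⟩
  P s * 1#                               ≈⟨ PS.*-identityʳ (P s) ⟩
  P s                                    ∎
  where open ≈-Reasoning
P-Y s (suc a) rewrite ℕ.+-comm s (suc a) = begin
  P (suc m) * (1# + q^ (suc (suc m))) * (Y (suc s) a * y (suc (suc m)))
    ≈⟨ solve 4 (λ p x Y y → p :* x :* (Y :* y) := p :* Y :* (x :* y)) PS.≈-refl
         (P (suc m)) (1# + q^ (suc (suc m))) (Y (suc s) a) (y (suc (suc m))) ⟩
  P (suc m) * Y (suc s) a * ((1# + q^ (suc (suc m))) * y (suc (suc m)))
    ≈⟨ *-cong {P (suc m) * Y (suc s) a} {P s} (P-Y s a) (*-y (suc m)) ⟩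
  P s * 1#
    ≈⟨ PS.*-identityʳ (P s) ⟩
  P s ∎
  where
  open ≈-Reasoning
  open Solver
  m = a ℕ.+ s

-- Each step adds the size a + s + 1. If it occurs, it is the first row and contributes one new box
-- of arm a, in column s + 1; all other such boxes lie in the rows below.
distinct-boxes : ∀ a l s → gf (a ℕ.+ s) (distinct · boxes a l) ≈ P (a ℕ.+ s) * (q^ a * ε a l * ∑u (suc l) a s)
distinct-boxes a l zero    = ≈-trans
  (gf-·-0 (a ℕ.+ 0) distinct (λ λ′ p → boxes-vanish a l λ′ (subst (λ k → All (_≤ k) λ′) (ℕ.+-identityʳ a) p)))
  (≈-sym (≈-trans (*-congˡ (P (a ℕ.+ 0)) (PS.zeroʳ (q^ a * ε a l))) (PS.zeroʳ (P (a ℕ.+ 0)))))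
distinct-boxes a l (suc s) rewrite ℕ.+-suc a s = begin
  gf (suc m) (distinct · boxes a l)
    ≈⟨ distinct-suc m (boxes a l) ⟩
  F + q^ (suc m) * gf m (distinct · (boxes a l ∘ (suc m ∷_)))
    ≈⟨ +-congˡ F (*-cong {q^ (suc m)} {q^ a * q^ (suc s)} exponent (≈-trans
         (gf-cong m (λ λ′ _ → cong (distinct λ′ ℚ.*_) (boxes-top a l s λ′)))
         (gf-·-+ m distinct (legs (suc s) l) (boxes a l)))) ⟩
  F + q^ a * q^ (suc s) * (gf m (distinct · legs (suc s) l) + F)
    ≈⟨ +-cong IH (*-congˡ (q^ a * q^ (suc s)) (+-cong K IH)) ⟩
  P m * (q^ a * ε a l * Σ) + q^ a * q^ (suc s) * (P m * (1# + q^ a * q^ (suc s)) * Y (suc s) a * (X * ε a l) + P m * (q^ a * ε a l * Σ))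
    ≈⟨ solve 7 (λ p A x X e t Y →
           p :* (A :* e :* t) :+ A :* x :* (p :* (con 1ℚ :+ A :* x) :* Y :* (X :* e) :+ p :* (A :* e :* t))
           := p :* (con 1ℚ :+ A :* x) :* (A :* e :* (t :+ x :* (X :* Y)))) PS.≈-refl
         (P m) (q^ a) (q^ (suc s)) X (ε a l) Σ (Y (suc s) a) ⟩
  P m * (1# + q^ a * q^ (suc s)) * (q^ a * ε a l * (Σ + q^ (suc s) * (X * Y (suc s) a)))
    ≈⟨ *-cong {P m * (1# + q^ (suc m))} {P m * (1# + q^ a * q^ (suc s))} (*-congˡ (P m) (+-congˡ 1# exponent))
         (*-congˡ (q^ a * ε a l) (+-congˡ Σ (u-suc l a (suc s)))) ⟨
  P (suc m) * (q^ a * ε a l * ∑u (suc l) a (suc s)) ∎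
  where
  open ≈-Reasoning
  open Solver
  m = a ℕ.+ s
  F = gf m (distinct · boxes a l)
  Σ = ∑u (suc l) a s
  X = q^ (suc s ℕ.* l)
  IH : F ≈ P m * (q^ a * ε a l * Σ)
  IH = distinct-boxes a l s
  exponent : q^ (suc m) ≈ q^ a * q^ (suc s)
  exponent = ≈-trans (λ n → cong (λ k → q^ k n) (sym (ℕ.+-suc a s))) (q^-+ a (suc s))
  K : gf m (distinct · legs (suc s) l) ≈ P m * (1# + q^ a * q^ (suc s)) * Y (suc s) a * (X * ε a l)
  -- Enlarging `P s` to `P (suc m)` introduces the factors 1 + q^(s+1), ..., 1 + q^(m+1), whose
  -- inverses make up `Y (suc s) a`.
  K = ≈-trans (distinct-legs s a l) (*-congʳ (X * ε a l) (≈-trans (≈-sym (P-Y s a))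
        (*-congʳ (Y (suc s) a) (*-congˡ (P m) (+-congˡ 1# exponent)))))

P⟶⟨-q,q⟩∞ : P ⟶ ⟨-q,q⟩∞
P⟶⟨-q,q⟩∞ = ⟶-∏∞ (λ j → 1# + q^ j) λ N i i≤N → +-cancelled (q^-low (suc N) i (s≤s i≤N))

distinct-boxes∞ : ∀ a l → gf∞ (distinct · boxes a l) ≈ ⟨-q,q⟩∞ * Z a l
distinct-boxes∞ a l = ⟶-unique
  (⟶-subsequence (a ℕ.+_) (λ N → ℕ.m≤n+m N a) (gf⟶gf∞ (distinct · boxes a l)))
  (⟶-cong (λ s → ≈-sym (distinct-boxes a l s))
    (⟶-* (⟶-subsequence (a ℕ.+_) (λ N → ℕ.m≤n+m N a) P⟶⟨-q,q⟩∞)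
         (⟶-* (⟶-const (q^ a * ε a l)) (∑u⟶T l a))))

-- Partitions into odd parts

-- The indicator of odd numbers, valued in series so that even sizes can stay in every product with
-- a vanishing contribution. Its period 2 holds by computation.
χ : ℕ → PowerSeries
χ zero          = 0#
χ (suc zero)    = 1#
χ (suc (suc m)) = χ m

χ-even : ∀ m → 2 ∣ℕ m → χ m ≡ 0#
χ-even zero          _     = refl
χ-even (suc zero)    2∣1   with () ← ∣1⇒≡1 2∣1
χ-even (suc (suc m)) 2∣2+m = χ-even m (∣m+n∣m⇒∣n 2∣2+m ∣-refl)

χ-odd : ∀ m → ¬ 2 ∣ℕ m → χ m ≡ 1#
χ-odd zero          2∤0   = contradiction (2 ∣0) 2∤0
χ-odd (suc zero)    _     = refl
χ-odd (suc (suc m)) 2∤2+m = χ-odd m λ 2∣m → 2∤2+m (∣m∣n⇒∣m+n ∣-refl 2∣m)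

χ-double : ∀ m → χ (m ℕ.+ m) ≡ 0# × χ (suc (m ℕ.+ m)) ≡ 1#
χ-double zero    = refl , refl
χ-double (suc m) rewrite ℕ.+-suc m m = χ-double m

rational-χ : ∀ m → Rational (χ m)
rational-χ zero          = rational-0#
rational-χ (suc zero)    = rational-1#
rational-χ (suc (suc m)) = rational-χ m

-- If i and j have the same parity, the two indicators coincide and are idempotent; otherwise they
-- are disjoint. So a product of parity conditions on s reduces to one of them times a factor
-- independent of s.
χ-* : ∀ i j s → χ (i ℕ.+ s) * χ (j ℕ.+ s) ≈ χ (suc (i ℕ.+ j)) * χ (i ℕ.+ s)
χ-* zero          zero          zero          n = trans (*-zeroˡ 0# n) (sym (*-identityˡ 0# n))
χ-* zero          zero          (suc zero)    n = refl
χ-* zero          zero          (suc (suc s)) n = χ-* zero zero s n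
χ-* zero          (suc zero)    zero          n = trans (*-zeroˡ 1# n) (sym (*-zeroˡ 0# n))
χ-* zero          (suc zero)    (suc zero)    n = *-comm 1# 0# n
χ-* zero          (suc zero)    (suc (suc s)) n = χ-* zero (suc zero) s n
χ-* zero          (suc (suc j)) s             n = χ-* zero j s n
χ-* (suc zero)    zero          zero          n = *-comm 1# 0# n
χ-* (suc zero)    zero          (suc zero)    n = trans (*-zeroˡ 1# n) (sym (*-zeroˡ 0# n))
χ-* (suc zero)    zero          (suc (suc s)) n = χ-* (suc zero) zero s n
χ-* (suc zero)    (suc zero)    zero          n = refl
χ-* (suc zero)    (suc zero)    (suc zero)    n = trans (*-zeroˡ 0# n) (sym (*-identityˡ 0# n))
χ-* (suc zero)    (suc zero)    (suc (suc s)) n = χ-* (suc zero) (suc zero) s n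
χ-* (suc zero)    (suc (suc j)) s             n = χ-* (suc zero) j s n
χ-* (suc (suc i)) j             s             n = χ-* i j s n

v : ℕ → PowerSeries
v m = χ m * q^ m

q^∣-*ʳ : ∀ k {f} g → q^ k ∣ f → q^ k ∣ (f * g)
q^∣-*ʳ k {f} g f∣ i i<k = trans
  (*-cong-≤ {f} {0#} {g} {g} i (λ j j≤i → f∣ j (ℕ.≤-<-trans j≤i i<k)) (λ _ _ → refl)) (*-zeroˡ g i)

q^∣v : ∀ m → q^ m ∣ v m
q^∣v m i i<m = trans (*-comm (χ m) (q^ m) i) (q^∣q^* m (χ m) i i<m)

1-v-0 : ∀ m → (1# - v (suc m)) 0 ≡ 1ℚ
1-v-0 m = cong (λ x → 1ℚ ℚ.- x) (q^∣v (suc m) 0 (s≤s z≤n))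

odd : Weight
odd λ′ = 𝟙 (all? (λ x → ¬? (2 ∣? x)) λ′)

odd-cons-even : ∀ {x} λ′ → 2 ∣ℕ x → odd (x ∷ λ′) ≡ 0ℚ
odd-cons-even {x} λ′ 2∣x = 𝟙-false (all? (λ x → ¬? (2 ∣? x)) (x ∷ λ′)) λ { (2∤x ∷ _) → 2∤x 2∣x }

odd-cons-odd : ∀ {x} λ′ → ¬ 2 ∣ℕ x → odd (x ∷ λ′) ≡ odd λ′
odd-cons-odd {x} λ′ 2∤x = 𝟙-⇔ (all? (λ x → ¬? (2 ∣? x)) (x ∷ λ′)) (all? (λ x → ¬? (2 ∣? x)) λ′)
  (λ { (_ ∷ p) → p }) (2∤x ∷_)

odd-suc : ∀ m w → gf (suc m) (odd · w) ≈ gf m (odd · w) + v (suc m) * gf (suc m) (odd · (w ∘ (suc m ∷_)))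
odd-suc m w = ≈-trans (gf-suc m (odd · w)) (+-congˡ (gf m (odd · w)) (rest (2 ∣? suc m)))
  where
  open ≈-Reasoning
  H = gf (suc m) (odd · (w ∘ (suc m ∷_)))
  rest : Dec (2 ∣ℕ suc m) → q^ (suc m) * gf (suc m) ((odd · w) ∘ (suc m ∷_)) ≈ v (suc m) * H
  rest (yes 2∣m) = begin
    q^ (suc m) * gf (suc m) ((odd · w) ∘ (suc m ∷_))
      ≈⟨ *-congˡ (q^ (suc m)) (≈-trans (gf-cong (suc m) (λ λ′ _ → trans
           (cong (ℚ._* w (suc m ∷ λ′)) (odd-cons-even λ′ 2∣m)) (ℚ.*-zeroˡ (w (suc m ∷ λ′))))) (gf-0 (suc m))) ⟩
    q^ (suc m) * 0#
      ≈⟨ PS.zeroʳ (q^ (suc m)) ⟩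
    0#
      ≈⟨ *-zeroˡ H ⟨
    0# * H
      ≈⟨ *-congʳ H (*-zeroˡ (q^ (suc m))) ⟨
    0# * q^ (suc m) * H
      ≈⟨ (λ n → cong (λ c → (c * q^ (suc m) * H) n) (sym (χ-even (suc m) 2∣m))) ⟩
    v (suc m) * H ∎
  rest (no 2∤m) = begin
    q^ (suc m) * gf (suc m) ((odd · w) ∘ (suc m ∷_))
      ≈⟨ *-congˡ (q^ (suc m)) (gf-cong (suc m) (λ λ′ _ → cong (ℚ._* w (suc m ∷ λ′)) (odd-cons-odd λ′ 2∤m))) ⟩
    q^ (suc m) * H
      ≈⟨ *-congʳ H (*-identityˡ (q^ (suc m))) ⟨
    1# * q^ (suc m) * H
      ≈⟨ (λ n → cong (λ c → (c * q^ (suc m) * H) n) (sym (χ-odd (suc m) 2∤m))) ⟩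
    v (suc m) * H ∎

G : ℕ → PowerSeries
G m = gf m (odd · one)

G-suc : ∀ m → G m ≈ (1# - v (suc m)) * G (suc m)
G-suc m = begin
  G m
    ≈⟨ solve 2 (λ g x → g := g :+ x :- x) PS.≈-refl (G m) (v (suc m) * G (suc m)) ⟩
  G m + v (suc m) * G (suc m) - v (suc m) * G (suc m)
    ≈⟨ minus-cong {g = v (suc m) * G (suc m)} (odd-suc m one) (λ _ → refl) ⟨
  G (suc m) - v (suc m) * G (suc m)
    ≈⟨ solve 2 (λ g v → g :- v :* g := (con 1ℚ :- v) :* g) PS.≈-refl (G (suc m)) (v (suc m)) ⟩
  (1# - v (suc m)) * G (suc m) ∎
  where
  open ≈-Reasoning
  open Solver

-- The complete homogeneous symmetric polynomial of degree l in the odd powers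
-- among q^{s+1}, …, q^{s+i}, and the product of 1 - q^m over the same exponents m.
η : ℕ → ℕ → ℕ → PowerSeries
η s zero    zero    = 1#
η s zero    (suc l) = 0#
η s (suc i) zero    = η s i zero
η s (suc i) (suc l) = η s i (suc l) + v (suc i ℕ.+ s) * η s (suc i) l

ω : ℕ → ℕ → PowerSeries
ω s zero    = 1#
ω s (suc i) = ω s i * (1# - v (suc i ℕ.+ s))

G-ω : ∀ s i → G s ≈ G (i ℕ.+ s) * ω s i
G-ω s zero    = ≈-sym (PS.*-identityʳ (G s))
G-ω s (suc i) = begin
  G s
    ≈⟨ G-ω s i ⟩
  G (i ℕ.+ s) * ω s i
    ≈⟨ *-congʳ (ω s i) (G-suc (i ℕ.+ s)) ⟩
  (1# - v (suc i ℕ.+ s)) * G (suc i ℕ.+ s) * ω s i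
    ≈⟨ solve 3 (λ a g w → a :* g :* w := g :* (w :* a)) PS.≈-refl (1# - v (suc i ℕ.+ s)) (G (suc i ℕ.+ s)) (ω s i) ⟩
  G (suc i ℕ.+ s) * ω s (suc i) ∎
  where
  open ≈-Reasoning
  open Solver

odd-legs : ∀ s i l → gf (i ℕ.+ s) (odd · legs (suc s) l) ≈ G s * η s i l
odd-legs s zero    zero    = ≈-trans (gf-cong s (λ λ′ p → cong (odd λ′ ℚ.*_) (legs-none s λ′ p))) (≈-sym (PS.*-identityʳ (G s)))
odd-legs s zero    (suc l) = ≈-trans (gf-·-0 s odd (legs-some s l)) (≈-sym (PS.zeroʳ (G s)))
odd-legs s (suc i) zero    = begin
  gf (suc i ℕ.+ s) (odd · legs (suc s) 0)
    ≈⟨ odd-suc (i ℕ.+ s) (legs (suc s) 0) ⟩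
  gf (i ℕ.+ s) (odd · legs (suc s) 0) + v (suc i ℕ.+ s) * gf (suc i ℕ.+ s) (odd · (legs (suc s) 0 ∘ (suc (i ℕ.+ s) ∷_)))
    ≈⟨ +-cong (odd-legs s i zero) (*-congˡ (v (suc i ℕ.+ s)) (gf-·-0 (suc i ℕ.+ s) odd (λ λ′ _ → legs-cons-zero λ′ (s≤s (ℕ.m≤n+m s i))))) ⟩
  G s * η s i zero + v (suc i ℕ.+ s) * 0#
    ≈⟨ (λ n → +-cancelled (PS.zeroʳ (v (suc i ℕ.+ s)) n)) ⟩
  G s * η s i zero ∎
  where open ≈-Reasoning
odd-legs s (suc i) (suc l) = begin
  gf (suc i ℕ.+ s) (odd · legs (suc s) (suc l))
    ≈⟨ odd-suc (i ℕ.+ s) (legs (suc s) (suc l)) ⟩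
  gf (i ℕ.+ s) (odd · legs (suc s) (suc l)) + v (suc i ℕ.+ s) * gf (suc i ℕ.+ s) (odd · (legs (suc s) (suc l) ∘ (suc (i ℕ.+ s) ∷_)))
    ≈⟨ +-cong (odd-legs s i (suc l)) (*-congˡ (v (suc i ℕ.+ s)) (≈-trans
         (gf-cong (suc i ℕ.+ s) (λ λ′ _ → cong (odd λ′ ℚ.*_) (legs-cons-suc l λ′ (s≤s (ℕ.m≤n+m s i)))))
         (odd-legs s (suc i) l))) ⟩
  G s * η s i (suc l) + v (suc i ℕ.+ s) * (G s * η s (suc i) l)
    ≈⟨ solve 4 (λ g v e e′ → g :* e′ :+ v :* (g :* e) := g :* (e′ :+ v :* e)) PS.≈-refl
         (G s) (v (suc i ℕ.+ s)) (η s (suc i) l) (η s i (suc l)) ⟩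
  G s * η s (suc i) (suc l) ∎
  where
  open ≈-Reasoning
  open Solver

-- Here p = s + a + 1 is the row length and s + 1 the column of its box of arm a. The rows below
-- that reach this column have odd lengths from s + 1 to p with repetition, counted by `η`; `ω`
-- withdraws the free choice of the sizes s + 1, ..., s + a. Copies of p above the row stay free, so
-- `ω` stops before p.
φ : ℕ → ℕ → ℕ → PowerSeries
φ a l s = v (suc a ℕ.+ s) * (ω s a * η s (suc a) l)

odd-boxes : ∀ a l s → gf (a ℕ.+ s) (odd · boxes a l) ≈ G (a ℕ.+ s) * partialSum (φ a l) s
odd-boxes a l zero    = ≈-trans
  (gf-·-0 (a ℕ.+ 0) odd (λ λ′ p → boxes-vanish a l λ′ (subst (λ k → All (_≤ k) λ′) (ℕ.+-identityʳ a) p)))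
  (≈-sym (PS.zeroʳ (G (a ℕ.+ 0))))
-- Parts may repeat, so the recursion expresses `F′` through itself; multiplying by `1# - V` solves
-- for it.
odd-boxes a l (suc s) rewrite ℕ.+-suc a s = *-cancelˡ (1# - V) {F′} (1-v-0 m) (begin
  (1# - V) * F′
    ≈⟨ solve 2 (λ v f → (con 1ℚ :- v) :* f := f :- v :* f) PS.≈-refl V F′ ⟩
  F′ - V * F′
    ≈⟨ minus-cong {g = V * F′} step (λ _ → refl) ⟩
  F + V * (K + F′) - V * F′
    ≈⟨ solve 4 (λ f v k f′ → f :+ v :* (k :+ f′) :- v :* f′ := f :+ v :* k) PS.≈-refl F V K F′ ⟩
  F + V * K
    ≈⟨ +-cong (odd-boxes a l s) (*-congˡ V (≈-trans (odd-legs s (suc a) l) (*-congʳ (η s (suc a) l) (G-ω s a)))) ⟩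
  G m * Φ + V * (G m * ω s a * η s (suc a) l)
    ≈⟨ solve 5 (λ g f v w e → g :* f :+ v :* (g :* w :* e) := g :* (f :+ v :* (w :* e))) PS.≈-refl (G m) Φ V (ω s a) (η s (suc a) l) ⟩
  G m * (Φ + φ a l s)
    ≈⟨ *-congʳ (Φ + φ a l s) (G-suc m) ⟩
  (1# - V) * G (suc m) * (Φ + φ a l s)
    ≈⟨ *-assoc (1# - V) (G (suc m)) (Φ + φ a l s) ⟩
  (1# - V) * (G (suc m) * (Φ + φ a l s)) ∎)
  where
  open ≈-Reasoning
  open Solver
  m = a ℕ.+ s
  V = v (suc m)
  F = gf m (odd · boxes a l)
  F′ = gf (suc m) (odd · boxes a l)
  K = gf (suc m) (odd · legs (suc s) l)
  Φ = partialSum (φ a l) s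
  step : F′ ≈ F + V * (K + F′)
  step = ≈-trans (odd-suc m (boxes a l)) (+-congˡ F (*-congˡ V (≈-trans
    (gf-cong (suc m) (λ λ′ _ → cong (odd λ′ ℚ.*_) (boxes-top a l s λ′)))
    (gf-·-+ (suc m) odd (legs (suc s) l) (boxes a l)))))

q^∣φ : ∀ a l s → q^ s ∣ φ a l s
q^∣φ a l s i i<s = q^∣-*ʳ (suc a ℕ.+ s) (ω s a * η s (suc a) l) (q^∣v (suc a ℕ.+ s)) i (ℕ.<-≤-trans i<s (ℕ.m≤n+m s (suc a)))

odd-boxes∞ : ∀ a l → gf∞ (odd · boxes a l) ≈ gf∞ (odd · one) * series (φ a l)
odd-boxes∞ a l = ⟶-unique
  (⟶-subsequence (a ℕ.+_) (λ N → ℕ.m≤n+m N a) (gf⟶gf∞ (odd · boxes a l)))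
  (⟶-cong (λ s → ≈-sym (odd-boxes a l s))
    (⟶-* (⟶-subsequence (a ℕ.+_) (λ N → ℕ.m≤n+m N a) (gf⟶gf∞ (odd · one)))
         (⟶-series (φ a l) (q^∣φ a l))))

-- Rationality of the sums over odd parts

series-cong : ∀ {f g} → (∀ s → f s ≈ g s) → series f ≈ series g
series-cong f≈g n = partialSum-cong f≈g (suc n) n

series-+ : ∀ f g → series (λ s → f s + g s) ≈ series f + series g
series-+ f g n = partialSum-+ f g (suc n) n

q^∣-*ˡ : ∀ k f {g} → q^ k ∣ g → q^ k ∣ (f * g)
q^∣-*ˡ k f {g} g∣ i i<k = trans (*-comm f g i) (q^∣-*ʳ k {g} f g∣ i i<k)

series-* : ∀ c f → (∀ s → q^ s ∣ f s) → series (λ s → c * f s) ≈ c * series f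
series-* c f f∣ = ⟶-unique (⟶-series (λ s → c * f s) (λ s → q^∣-*ˡ s c {f s} (f∣ s)))
  (⟶-cong (λ N → ≈-sym (partialSum-* c f N)) (⟶-* (⟶-const c) (⟶-series f f∣)))

series-suc : ∀ f → (∀ s → q^ s ∣ f s) → (∀ s → q^ s ∣ f (suc s)) → series f ≈ f 0 + series (f ∘ suc)
series-suc f f∣ f∣′ = ⟶-unique (⟶-subsequence suc (ℕ.n≤1+n) (⟶-series f f∣))
  (⟶-cong (λ N → ≈-sym (partialSum-suc f N)) (⟶-+ (⟶-const (f 0)) (⟶-series (f ∘ suc) f∣′)))

-- The positive exponent `suc k` ensures convergence for every `f`. The offset `e` selects a parity
-- of s, and shifting s by one turns `e` into `suc e`.
term : ℕ → ℕ → (ℕ → PowerSeries) → ℕ → PowerSeries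
term k e f s = q^ (suc k ℕ.* s) * (χ (e ℕ.+ s) * f s)

q^∣term : ∀ k e f s → q^ s ∣ term k e f s
q^∣term k e f s i i<s = q^∣q^* (suc k ℕ.* s) (χ (e ℕ.+ s) * f s) i (ℕ.<-≤-trans i<s (ℕ.m≤m+n s (k ℕ.* s)))

-- The sequences f whose sums against q^{(k+1)s}, over the s of either parity, are
-- all rational; this class is closed under the operations that build η and ω.
Summable : (ℕ → PowerSeries) → Set
Summable f = ∀ k e → Rational (series (term k e f))

summable-cong : ∀ {f g} → (∀ s → f s ≈ g s) → Summable f → Summable g
summable-cong f≈g r k e = rational-≈
  (series-cong (λ s → *-congˡ (q^ (suc k ℕ.* s)) (*-congˡ (χ (e ℕ.+ s)) (f≈g s)))) (r k e)

summable-+ : ∀ {f g} → Summable f → Summable g → Summable (λ s → f s + g s)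
summable-+ {f} {g} r r′ k e = rational-≈ (≈-trans (≈-sym (series-+ (term k e f) (term k e g))) (series-cong λ s →
  solve 4 (λ q c f g → q :* (c :* f) :+ q :* (c :* g) := q :* (c :* (f :+ g))) PS.≈-refl
    (q^ (suc k ℕ.* s)) (χ (e ℕ.+ s)) (f s) (g s)))
  (rational-+ (r k e) (r′ k e))
  where open Solver

summable-scale : ∀ {c f} → Rational c → Summable f → Summable (λ s → c * f s)
summable-scale {c} {f} rc r k e = rational-≈ (≈-trans (≈-sym (series-* c (term k e f) (q^∣term k e f))) (series-cong λ s →
  solve 4 (λ c q x f → c :* (q :* (x :* f)) := q :* (x :* (c :* f))) PS.≈-refl
    c (q^ (suc k ℕ.* s)) (χ (e ℕ.+ s)) (f s)))
  (rational-* rc (r k e))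
  where open Solver

summable-q^ : ∀ {f} → Summable f → Summable (λ s → q^ s * f s)
summable-q^ {f} r k e = rational-≈ (series-cong λ s → ≈-trans (*-congʳ (χ (e ℕ.+ s) * f s) (q^-+ s (suc k ℕ.* s)))
  (solve 4 (λ q p x f → q :* p :* (x :* f) := p :* (x :* (q :* f))) PS.≈-refl (q^ s) (q^ (suc k ℕ.* s)) (χ (e ℕ.+ s)) (f s)))
  (r (suc k) e)
  where open Solver

summable-χ : ∀ {f} i → Summable f → Summable (λ s → χ (i ℕ.+ s) * f s)
summable-χ {f} i r k e = rational-≈ (≈-trans (≈-sym (series-* c (term k e f) (q^∣term k e f))) (series-cong λ s → begin
  c * (q^ (suc k ℕ.* s) * (χ (e ℕ.+ s) * f s))
    ≈⟨ solve 4 (λ c q x f → c :* (q :* (x :* f)) := q :* (c :* x :* f)) PS.≈-refl c (q^ (suc k ℕ.* s)) (χ (e ℕ.+ s)) (f s) ⟩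
  q^ (suc k ℕ.* s) * (c * χ (e ℕ.+ s) * f s)
    ≈⟨ *-congˡ (q^ (suc k ℕ.* s)) (*-congʳ (f s) (χ-* e i s)) ⟨
  q^ (suc k ℕ.* s) * (χ (e ℕ.+ s) * χ (i ℕ.+ s) * f s)
    ≈⟨ *-congˡ (q^ (suc k ℕ.* s)) (*-assoc (χ (e ℕ.+ s)) (χ (i ℕ.+ s)) (f s)) ⟩
  term k e (λ s → χ (i ℕ.+ s) * f s) s ∎))
  (rational-* (rational-χ (suc (e ℕ.+ i))) (r k e))
  where
  open ≈-Reasoning
  open Solver
  c = χ (suc (e ℕ.+ i))

-- A shift of s by one extracts q^(k+1) and swaps the parities. Two shifts return to the same sum,
-- which is thereby a geometric series of ratio q^(2k+2).
summable-1# : Summable (λ _ → 1#)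
summable-1# k e = rational-divide-1-q^ (k ℕ.+ suc k) (rational-≈ (≈-sym identity)
  (rational-+ (rational-χ e) (rational-* (rational-q^ (suc k)) (rational-χ (suc e)))))
  where
  open ≈-Reasoning
  open Solver
  Q = q^ (suc k)
  X : ℕ → PowerSeries
  X e = series (term k e (λ _ → 1#))
  first : ∀ e → term k e (λ _ → 1#) 0 ≈ χ e
  first e rewrite ℕ.*-zeroʳ k | ℕ.+-identityʳ e = ≈-trans (*-identityˡ (χ e * 1#)) (PS.*-identityʳ (χ e))
  next : ∀ e s → term k e (λ _ → 1#) (suc s) ≈ Q * term k (suc e) (λ _ → 1#) s
  next e s rewrite ℕ.+-suc e s = ≈-trans
    (*-congʳ (χ (suc (e ℕ.+ s)) * 1#) (≈-trans (λ n → cong (λ j → q^ j n) (ℕ.*-suc (suc k) s)) (q^-+ (suc k) (suc k ℕ.* s))))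
    (*-assoc Q (q^ (suc k ℕ.* s)) (χ (suc (e ℕ.+ s)) * 1#))
  recurrence : ∀ e → X e ≈ χ e + Q * X (suc e)
  recurrence e = begin
    X e
      ≈⟨ series-suc (term k e (λ _ → 1#)) (q^∣term k e (λ _ → 1#))
           (λ s i i<s → q^∣term k e (λ _ → 1#) (suc s) i (ℕ.m<n⇒m<1+n i<s)) ⟩
    term k e (λ _ → 1#) 0 + series (term k e (λ _ → 1#) ∘ suc)
      ≈⟨ +-cong (first e) (≈-trans (series-cong (next e)) (series-* Q (term k (suc e) (λ _ → 1#)) (q^∣term k (suc e) (λ _ → 1#)))) ⟩
    χ e + Q * X (suc e) ∎
  identity : (1# - q^ (suc (k ℕ.+ suc k))) * X e ≈ χ e + Q * χ (suc e)
  identity = begin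
    (1# - q^ (suc k ℕ.+ suc k)) * X e
      ≈⟨ *-congʳ (X e) (minus-congˡ 1# (q^-+ (suc k) (suc k))) ⟩
    (1# - Q * Q) * X e
      ≈⟨ solve 2 (λ q x → (con 1ℚ :- q :* q) :* x := x :- q :* (q :* x)) PS.≈-refl Q (X e) ⟩
    X e - Q * (Q * X e)
      -- The second use of `recurrence` ends in `X (suc (suc e))`, which computes to `X e` by the
      -- period of `χ`.
      ≈⟨ minus-cong {g = Q * (Q * X e)} (≈-trans (recurrence e) (+-congˡ (χ e) (*-congˡ Q (recurrence (suc e))))) (λ _ → refl) ⟩
    χ e + Q * (χ (suc e) + Q * X e) - Q * (Q * X e)
      ≈⟨ solve 4 (λ q x a b → a :+ q :* (b :+ q :* x) :- q :* (q :* x) := a :+ q :* b) PS.≈-refl Q (X e) (χ e) (χ (suc e)) ⟩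
    χ e + Q * χ (suc e) ∎

summable-v : ∀ {f} i → Summable f → Summable (λ s → v (i ℕ.+ s) * f s)
summable-v {f} i r = summable-cong
  (λ s → ≈-sym (≈-trans (*-congʳ (f s) (*-congˡ (χ (i ℕ.+ s)) (q^-+ i s)))
    (solve 4 (λ x a b f → x :* (a :* b) :* f := a :* (b :* (x :* f))) PS.≈-refl (χ (i ℕ.+ s)) (q^ i) (q^ s) (f s))))
  (summable-scale (rational-q^ i) (summable-q^ (summable-χ i r)))
  where open Solver

summable-η : ∀ i l → Summable (λ s → η s i l)
summable-η zero    zero    = summable-1#
summable-η zero    (suc l) = summable-cong (λ _ → *-zeroˡ 1#) (summable-scale rational-0# summable-1#)
summable-η (suc i) zero    = summable-η i zero
summable-η (suc i) (suc l) = summable-+ (summable-η i (suc l)) (summable-v (suc i) (summable-η (suc i) l))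

summable-ω : ∀ i {f} → Summable f → Summable (λ s → ω s i * f s)
summable-ω zero    {f} r = summable-cong (λ s → ≈-sym (*-identityˡ (f s))) r
summable-ω (suc i) {f} r = summable-cong
  (λ s → solve 3 (λ w v f → w :* (f :+ con (ℚ.- 1ℚ) :* (v :* f)) := w :* (con 1ℚ :- v) :* f) PS.≈-refl (ω s i) (v (suc i ℕ.+ s)) (f s))
  (summable-ω i (summable-+ r (summable-scale (rational-constant (ℚ.- 1ℚ)) (summable-v (suc i) r))))
  where open Solver

rational-φ : ∀ a l → Rational (series (φ a l))
rational-φ a l = rational-≈ (series-cong λ s → begin
    q^ (1 ℕ.* s) * (χ (suc a ℕ.+ s) * (q^ (suc a) * (ω s a * η s (suc a) l)))
      ≈⟨ (λ n → cong (λ j → (q^ j * (χ (suc a ℕ.+ s) * (q^ (suc a) * (ω s a * η s (suc a) l)))) n) (ℕ.+-identityʳ s)) ⟩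
    q^ s * (χ (suc a ℕ.+ s) * (q^ (suc a) * (ω s a * η s (suc a) l)))
      ≈⟨ solve 4 (λ b x a f → b :* (x :* (a :* f)) := x :* (a :* b) :* f) PS.≈-refl (q^ s) (χ (suc a ℕ.+ s)) (q^ (suc a)) (ω s a * η s (suc a) l) ⟩
    χ (suc a ℕ.+ s) * (q^ (suc a) * q^ s) * (ω s a * η s (suc a) l)
      ≈⟨ *-congʳ (ω s a * η s (suc a) l) (*-congˡ (χ (suc a ℕ.+ s)) (q^-+ (suc a) s)) ⟨
    φ a l s ∎)
  -- The factor `v (suc a ℕ.+ s)` of `φ` supplies both the weight q^s, hence k = 0, and the parity
  -- condition with offset `suc a`.
  (summable-scale (rational-q^ (suc a)) (summable-ω a (summable-η (suc a) l)) 0 (suc a))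
  where
  open ≈-Reasoning
  open Solver

-- Euler's theorem

O Q Q² : ℕ → PowerSeries
O  m = ∏ m (λ j → 1# - v j)
Q  m = ∏ m (λ j → 1# - q^ j)
Q² m = ∏ m (λ j → 1# - q^ (j ℕ.+ j))

G-O : ∀ m → G m * O m ≈ 1#
G-O zero    = ≈-trans (*-congʳ 1# (gf-zero (odd · one) refl)) (*-identityˡ 1#)
G-O (suc m) = begin
  G (suc m) * (O m * (1# - v (suc m)))
    ≈⟨ solve 3 (λ g o w → g :* (o :* w) := (w :* g) :* o) PS.≈-refl (G (suc m)) (O m) (1# - v (suc m)) ⟩
  (1# - v (suc m)) * G (suc m) * O m
    ≈⟨ *-congʳ (O m) (G-suc m) ⟨
  G m * O m
    ≈⟨ G-O m ⟩
  1# ∎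
  where
  open ≈-Reasoning
  open Solver

Q-P : ∀ m → Q m * P m ≈ Q² m
Q-P zero    = *-identityˡ 1#
Q-P (suc m) = begin
  Q m * (1# - x) * (P m * (1# + x))
    ≈⟨ solve 3 (λ Q P x → Q :* (con 1ℚ :- x) :* (P :* (con 1ℚ :+ x)) := Q :* P :* (con 1ℚ :- x :* x)) PS.≈-refl (Q m) (P m) x ⟩
  Q m * P m * (1# - x * x)
    ≈⟨ *-cong {Q m * P m} {Q² m} {1# - x * x} {1# - q^ (suc m ℕ.+ suc m)} (Q-P m) (minus-congˡ 1# (≈-sym (q^-+ (suc m) (suc m)))) ⟩
  Q² (suc m) ∎
  where
  open ≈-Reasoning
  open Solver
  x = q^ (suc m)

-- Truncating at m + m makes the even exponents exactly the doubles of 1, ..., m.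
Q-O : ∀ m → Q (m ℕ.+ m) ≈ Q² m * O (m ℕ.+ m)
Q-O zero    = ≈-sym (*-identityˡ 1#)
Q-O (suc m) rewrite ℕ.+-suc m m = begin
  Q n * (1# - q^ (suc n)) * (1# - q^ (suc (suc n)))
    ≈⟨ *-congʳ (1# - q^ (suc (suc n))) (*-congʳ (1# - q^ (suc n)) (Q-O m)) ⟩
  Q² m * O n * (1# - q^ (suc n)) * (1# - q^ (suc (suc n)))
    ≈⟨ solve 4 (λ q o x y → q :* o :* (con 1ℚ :- x) :* (con 1ℚ :- y)
                := q :* (con 1ℚ :- y) :* (o :* (con 1ℚ :- con 1ℚ :* x) :* con 1ℚ)) PS.≈-refl
         (Q² m) (O n) (q^ (suc n)) (q^ (suc (suc n))) ⟩
  Q² m * (1# - q^ (suc (suc n))) * (O n * (1# - 1# * q^ (suc n)) * 1#)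
    ≈⟨ *-congˡ (Q² m * (1# - q^ (suc (suc n)))) (*-congˡ (O n * (1# - 1# * q^ (suc n)))
         (≈-sym (≈-trans (minus-congˡ 1# (*-zeroˡ (q^ (suc (suc n))))) (λ n → ℚ.+-identityʳ (1# n))))) ⟩
  Q² m * (1# - q^ (suc (suc n))) * (O n * (1# - 1# * q^ (suc n)) * (1# - 0# * q^ (suc (suc n))))
    ≈⟨ (λ k → cong₂ (λ a b → (Q² m * (1# - q^ (suc (suc n))) * (O n * (1# - a * q^ (suc n)) * (1# - b * q^ (suc (suc n))))) k)
         (sym (proj₂ (χ-double m))) (sym (proj₁ (χ-double m)))) ⟩
  Q² m * (1# - q^ (suc (suc n))) * (O n * (1# - v (suc n)) * (1# - v (suc (suc n)))) ∎
  where
  open ≈-Reasoning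
  open Solver
  n = m ℕ.+ m

⟶-∏∞-minus : ∀ (f : ℕ → PowerSeries) → (∀ N → q^ (suc N) ∣ f (suc N)) → (λ N → ∏ N (λ j → 1# - f j)) ⟶ ∏∞ (λ j → 1# - f j)
⟶-∏∞-minus f f∣ = ⟶-∏∞ (λ j → 1# - f j) λ N i i≤N →
  trans (cong (λ x → 1# i ℚ.- x) (f∣ N i (s≤s i≤N))) (ℚ.+-identityʳ (1# i))

-- The factorisation 1 - q^(2j) = (1 - q^j)(1 + q^j) and the splitting of exponents by parity give
-- two expressions involving `Q²∞`. Comparing them and cancelling `Q∞` shows that `O∞` is inverse to
-- `⟨-q,q⟩∞`; it is also inverse to `G∞`.
euler : gf∞ (odd · one) ≈ ⟨-q,q⟩∞
euler = begin
  G∞                        ≈⟨ PS.*-identityʳ G∞ ⟨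
  G∞ * 1#                   ≈⟨ *-congˡ G∞ P∞O∞ ⟨
  G∞ * (⟨-q,q⟩∞ * O∞)       ≈⟨ solve 3 (λ g p o → g :* (p :* o) := p :* (g :* o)) PS.≈-refl G∞ ⟨-q,q⟩∞ O∞ ⟩
  ⟨-q,q⟩∞ * (G∞ * O∞)       ≈⟨ *-congˡ ⟨-q,q⟩∞ (⟶-unique (⟶-* (gf⟶gf∞ (odd · one)) O⟶) (⟶-cong (λ m → ≈-sym (G-O m)) (⟶-const 1#))) ⟩
  ⟨-q,q⟩∞ * 1#              ≈⟨ PS.*-identityʳ ⟨-q,q⟩∞ ⟩
  ⟨-q,q⟩∞                   ∎
  where
  open ≈-Reasoning
  open Solver
  G∞ = gf∞ (odd · one)
  O∞ = ∏∞ (λ j → 1# - v j)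
  Q∞ = ∏∞ (λ j → 1# - q^ j)
  Q²∞ = ∏∞ (λ j → 1# - q^ (j ℕ.+ j))
  O⟶ : O ⟶ O∞
  O⟶ = ⟶-∏∞-minus v (λ N → q^∣v (suc N))
  Q⟶ : Q ⟶ Q∞
  Q⟶ = ⟶-∏∞-minus q^ (λ N → q^-low (suc N))
  Q²⟶ : Q² ⟶ Q²∞
  Q²⟶ = ⟶-∏∞-minus (λ j → q^ (j ℕ.+ j)) (λ N i i<N → q^-low (suc N ℕ.+ suc N) i (ℕ.<-≤-trans i<N (ℕ.m≤m+n (suc N) (suc N))))
  Q∞P∞ : Q∞ * ⟨-q,q⟩∞ ≈ Q²∞
  Q∞P∞ = ⟶-unique (⟶-* Q⟶ P⟶⟨-q,q⟩∞) (⟶-cong (λ m → ≈-sym (Q-P m)) Q²⟶)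
  doubling : ∀ {F L} → F ⟶ L → (λ m → F (m ℕ.+ m)) ⟶ L
  doubling = ⟶-subsequence (λ m → m ℕ.+ m) (λ m → ℕ.m≤m+n m m)
  Q∞≈ : Q∞ ≈ Q²∞ * O∞
  Q∞≈ = ⟶-unique (doubling Q⟶) (⟶-cong (λ m → ≈-sym (Q-O m)) (⟶-* Q²⟶ (doubling O⟶)))
  P∞O∞ : ⟨-q,q⟩∞ * O∞ ≈ 1#
  P∞O∞ = *-cancelˡ Q∞ refl (begin
    Q∞ * (⟨-q,q⟩∞ * O∞)  ≈⟨ *-assoc Q∞ ⟨-q,q⟩∞ O∞ ⟨
    Q∞ * ⟨-q,q⟩∞ * O∞    ≈⟨ *-congʳ O∞ Q∞P∞ ⟩
    Q²∞ * O∞             ≈⟨ Q∞≈ ⟨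
    Q∞                   ≈⟨ PS.*-identityʳ Q∞ ⟨
    Q∞ * 1#              ∎)

-- Assembling arms and legs into hook numbers

rational-∑ᵖ : ∀ k {V} → (∀ a l → Rational (V a l)) → Rational (∑ᵖ k V)
rational-∑ᵖ zero    r = r 0 0
rational-∑ᵖ (suc k) r = rational-+ (r 0 (suc k)) (rational-∑ᵖ k (r ∘ suc))

S : PowerSeries
S = ∑q^k/⟨1+q^k⟩

-- The antidiagonal a + l = k meets the diagonal a = l once if k is even, and never otherwise.
σ : ℕ → PowerSeries
σ zero          = S
σ (suc zero)    = 0#
σ (suc (suc k)) = σ k

σ-even : ∀ h → σ (2 ℕ.* h) ≡ S
σ-even zero    = refl
σ-even (suc h) rewrite ℕ.+-suc h (h ℕ.+ 0) = σ-even h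

σ-odd : ∀ h → σ (suc (2 ℕ.* h)) ≡ 0#
σ-odd zero    = refl
σ-odd (suc h) rewrite ℕ.+-suc h (h ℕ.+ 0) = σ-odd h

-- The two ends of the antidiagonal k + 2 lie off the diagonal. Removing them leaves the
-- antidiagonal k translated by (1,1), a translation that preserves the diagonal.
rational-∑ᵖ-σ : ∀ k V → (∀ a l → a ≢ l → Rational (V a l)) → (∀ a → Rational (V a a - S)) → Rational (∑ᵖ k V - σ k)
rational-∑ᵖ-σ zero          V off on = on 0
rational-∑ᵖ-σ (suc zero)    V off on = rational-minus (rational-+ (off 0 1 λ ()) (off 1 0 λ ())) rational-0#
rational-∑ᵖ-σ (suc (suc k)) V off on = rational-≈ (≈-sym identity)
  (rational-+ (rational-+ (off 0 (suc (suc k)) λ ()) (off (suc (suc k)) 0 λ ()))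
    (rational-∑ᵖ-σ k V′ (λ a l a≢l → off (suc a) (suc l) (a≢l ∘ ℕ.suc-injective)) (on ∘ suc)))
  where
  open ≈-Reasoning
  open Solver
  V′ : ℕ → ℕ → PowerSeries
  V′ a l = V (suc a) (suc l)
  identity : ∑ᵖ (suc (suc k)) V - σ k ≈ V 0 (suc (suc k)) + V (suc (suc k)) 0 + (∑ᵖ k V′ - σ k)
  identity = begin
    V 0 (suc (suc k)) + ∑ᵖ (suc k) (V ∘ suc) - σ k
      ≈⟨ minus-cong {g = σ k} (+-congˡ (V 0 (suc (suc k))) (∑ᵖ-last k (V ∘ suc))) (λ _ → refl) ⟩
    V 0 (suc (suc k)) + (∑ᵖ k V′ + V (suc (suc k)) 0) - σ k
      ≈⟨ solve 4 (λ a t b s → a :+ (t :+ b) :- s := a :+ b :+ (t :- s)) PS.≈-refl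
           (V 0 (suc (suc k))) (∑ᵖ k V′) (V (suc (suc k)) 0) (σ k) ⟩
    V 0 (suc (suc k)) + V (suc (suc k)) 0 + (∑ᵖ k V′ - σ k) ∎

-- Hook number k + 1 belongs to the antidiagonal k, so odd hook numbers have even k; there `σ k`
-- takes out the single exceptional series coming from the diagonal.
Ã B̃ : ℕ → PowerSeries
Ã zero    = 0#
Ã (suc k) = ∑ᵖ k (λ a l → series (φ a l))
B̃ zero    = 0#
B̃ (suc k) = ∑ᵖ k Z - σ k

ã≈ : ∀ k → ã (suc k) ≈ ⟨-q,q⟩∞ * Ã (suc k)
ã≈ k = begin
  ã (suc k)
    ≈⟨ hook-series (all? (λ x → ¬? (2 ∣? x))) k ⟩
  ∑ᵖ k (λ a l → gf∞ (odd · boxes a l))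
    ≈⟨ ∑ᵖ-cong k (λ a l → ≈-trans (odd-boxes∞ a l) (*-congʳ (series (φ a l)) euler)) ⟩
  ∑ᵖ k (λ a l → ⟨-q,q⟩∞ * series (φ a l))
    ≈⟨ ∑ᵖ-* k ⟨-q,q⟩∞ (λ a l → series (φ a l)) ⟩
  ⟨-q,q⟩∞ * Ã (suc k) ∎
  where open ≈-Reasoning

b̃≈ : ∀ k → b̃ (suc k) ≈ ⟨-q,q⟩∞ * (B̃ (suc k) + σ k)
b̃≈ k = begin
  b̃ (suc k)
    ≈⟨ hook-series unique? k ⟩
  ∑ᵖ k (λ a l → gf∞ (distinct · boxes a l))
    ≈⟨ ∑ᵖ-cong k distinct-boxes∞ ⟩
  ∑ᵖ k (λ a l → ⟨-q,q⟩∞ * Z a l)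
    ≈⟨ ∑ᵖ-* k ⟨-q,q⟩∞ Z ⟩
  ⟨-q,q⟩∞ * ∑ᵖ k Z
    ≈⟨ *-congˡ ⟨-q,q⟩∞ (solve 2 (λ z s → z := z :- s :+ s) PS.≈-refl (∑ᵖ k Z) (σ k)) ⟩
  ⟨-q,q⟩∞ * (B̃ (suc k) + σ k) ∎
  where
  open ≈-Reasoning
  open Solver

b̃-even : ∀ h → b̃ (2 ℕ.* suc h) ≈ ⟨-q,q⟩∞ * B̃ (2 ℕ.* suc h)
b̃-even h rewrite ℕ.+-suc h (h ℕ.+ 0) = ≈-trans (b̃≈ (suc (2 ℕ.* h)))
  (*-congˡ ⟨-q,q⟩∞ {B̃ (2 ℕ.+ 2 ℕ.* h) + σ (suc (2 ℕ.* h))} {B̃ (2 ℕ.+ 2 ℕ.* h)}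
    (λ n → +-cancelled (cong (λ s → s n) (σ-odd h))))

b̃-odd : ∀ h → b̃ (2 ℕ.* h ℕ.+ 1) ≈ ⟨-q,q⟩∞ * (B̃ (2 ℕ.* h ℕ.+ 1) + S)
b̃-odd h rewrite ℕ.+-comm (2 ℕ.* h) 1 = ≈-trans (b̃≈ (2 ℕ.* h))
  (*-congˡ ⟨-q,q⟩∞ {B̃ (suc (2 ℕ.* h)) + σ (2 ℕ.* h)} {B̃ (suc (2 ℕ.* h)) + S}
    (λ n → cong (λ s → B̃ (suc (2 ℕ.* h)) n ℚ.+ s n) (σ-even h)))

theorem2p2 : Σ[ A ∈ (ℕ → PowerSeries) ] Σ[ B ∈ (ℕ → PowerSeries) ]
    ( (∀ (h : ℕ) → 1 ≤ h → IsRational (A h) × IsRational (B h))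
    × (∀ (h : ℕ) → 1 ≤ h → ã h ≈ ⟨-q,q⟩∞ * A h)
    × (∀ (h : ℕ) → 1 ≤ h → b̃ (2 ℕ.* h) ≈ ⟨-q,q⟩∞ * B (2 ℕ.* h))
    × (∀ (h : ℕ) → b̃ (2 ℕ.* h ℕ.+ 1) ≈ ⟨-q,q⟩∞ * (B (2 ℕ.* h ℕ.+ 1) + ∑q^k/⟨1+q^k⟩)) )
theorem2p2 = Ã , B̃
  , (λ { (suc k) _ → Rational⇒IsRational (rational-∑ᵖ k λ a l → rational-φ a l)
                   , Rational⇒IsRational (rational-∑ᵖ-σ k Z rational-Z rational-Z-S) })
  , (λ { (suc k) _ → ã≈ k })
  , (λ { (suc h) _ → b̃-even h })
  , b̃-odd
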